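{- For every integer $n\ge 1$ let $C_n(q)$ be the polynomial defined below and write $$C_n(q)=c_{n,0}\,q^n+\sum_{i=1}^{n} c_{n,i}\,(q^{n+i}+q^{n-i})$$ with integers $c_{n,i}$ ($0\le i\le n$). Then: (a) $c_{n,0}=2(-1)^k$ if $n=k(k+1)/2$ for some integer $k\ge 1$, and $c_{n,0}=0$ otherwise. (b) For $1\le i\le n$: $$c_{n,i}=\begin{cases}(-1)^k & \text{if } n=k(k+2i+1)/2 \text{ for some integer } k\ge1,\\ (-1)^{k-1} & \text{if } n=k(k+2i-1)/2 \text{ for some integer } k\ge 1,\\ 0 & \text{otherwise.}\end{cases}$$
   Context: For each integer $n\ge1$, the Laurent polynomial $C_n(q)$ is defined by the identity of formal power series in $t$ $$1+\sum_{n\ge1}\frac{C_n(q)}{q^n}t^n=\prod_{i\ge1}\frac{(1-t^i)^2}{1-(q+q^{ -1})t^i+t^{2i}}.$$ It is known that $C_n(q)$ is a monic polynomial in $q$ with integer coefficients of degree $2n$ (it equals the number of ideals of codimension $n$ of $\mathbb{F}_q[x,y,x^{ -1},y^{ -1}]$ when $q$ is a prime power), and it is palindromic, i.e. $C_n(q)=q^{2n}C_n(q^{ -1})$, which is why it can be written in the displayed form. -}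

module Defs where

open import Data.Nat using (ℕ; zero; suc; _∸_; _≟_)
  renaming (_+_ to _+ℕ_; _*_ to _*ℕ_)
open import Data.Integer using (ℤ; +_; _+_; _-_; _*_; -1ℤ; 1ℤ; 0ℤ; _^_)
open import Data.Bool using (Bool; true; false; _∧_; if_then_else_)
open import Relation.Nullary.Decidable using (⌊_⌋)

-- A bivariate formal power series  Σ_{a,b} f a b · s^a q^b  over ℤ
-- (f a b = coefficient of s^a q^b).  ℤ[q][[s]] embeds in ℤ[[s,q]].
Series : Set
Series = ℕ → ℕ → ℤ

sumTo : ℕ → (ℕ → ℤ) → ℤ
sumTo zero    f = f zero
sumTo (suc n) f = sumTo n f + f (suc n)

_⊛_ : Series → Series → Series
(f ⊛ g) n j = sumTo n (λ a → sumTo j (λ b → f a b * g (n ∸ a) (j ∸ b)))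

_⊕_ : Series → Series → Series
(f ⊕ g) a b = f a b + g a b

_⊖_ : Series → Series → Series
(f ⊖ g) a b = f a b - g a b

mono : ℕ → ℕ → Series
mono a b a' b' = if ⌊ a ≟ a' ⌋ ∧ ⌊ b ≟ b' ⌋ then 1ℤ else 0ℤ

one : Series
one = mono 0 0

pow : Series → ℕ → Series
pow h zero    = one
pow h (suc k) = pow h k ⊛ h

-- 1 / (1 - h) = Σ_k h^k, for h with no s^0 terms (then only k ≤ n
-- contribute to the coefficient of s^n).
geom : Series → Series
geom h n j = sumTo n (λ k → pow h k n j)

-- After the substitution t = q·s, the i-th factor of the product
--   (1 - t^i)^2 / (1 - (q + q⁻¹) t^i + t^{2i})
-- becomes (1 - q^i s^i)^2 / (1 - (q^{i+1} + q^{i-1}) s^i + q^{2i} s^{2i}),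
-- which lies in ℤ[q][[s]]   (i ≥ 1).
factor : ℕ → Series
factor i = ((one ⊖ mono i i) ⊛ (one ⊖ mono i i))
           ⊛ geom ((mono i (suc i) ⊕ mono i (i ∸ 1)) ⊖ mono (2 *ℕ i) (2 *ℕ i))

prodF : ℕ → Series
prodF zero    = one
prodF (suc m) = prodF m ⊛ factor (suc m)

-- Since t^n / q^n = s^n, C_n(q) is the coefficient of s^n in the product;
-- only factors i ≤ n affect it.   C n j = coefficient of q^j in C_n(q).
C : ℕ → ℕ → ℤ
C n j = prodF n n j

sgn : ℕ → ℤ
sgn k = -1ℤ ^ k

{-# OPTIONS --safe #-}
module Submission where

-- With D_k = (1 - q t^k)(1 - q⁻¹ t^k), the finite product has the partial fraction expansion
--   ∏_{k≤N} (1 - t^k)² / D_k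
--     = 1 + ∑_{k=1}^N (-1)^k t^{k(k+1)/2} (1 + t^k)(2 - q - q⁻¹) r_{N,k} / D_k,
-- where r_{N,k} = (t)_N² / ((t)_{N-k} (t)_{N+k}). It is proved by induction on N from
-- D_N = t^{N-k} D_k + (1 - t^{N-k})(1 - t^{N+k}) and a telescoping sum. Modulo t^{N+1} the
-- factors r_{N,k} disappear, because t^k r_{N,k} = t^k, and each remaining term splits as
--   (-1)^k t^{k(k-1)/2} ((t^k - q t^k)/(1 - q t^k) + (t^k - q⁻¹ t^k)/(1 - q⁻¹ t^k)),
-- a sum of two geometric series from which the coefficients are read off.

open import Algebra.Bundles using (CommutativeRing)
open import Algebra.Bundles.Raw using (RawRing)
open import Algebra.Solver.Ring.AlmostCommutativeRing using (fromCommutativeRing; _-Raw-AlmostCommutative⟶_)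
import Algebra.Properties.AbelianGroup as AbelianGroupProperties
import Algebra.Properties.CommutativeSemiring.Exp as Exp
import Algebra.Properties.Ring as RingProperties
import Algebra.Properties.Semiring.Mult.TCOptimised as Multiples
import Algebra.Solver.Ring as RingSolver
open import Data.Bool using (_∧_; if_then_else_)
open import Data.Integer as ℤ using (ℤ; +_; -[1+_]; 0ℤ; 1ℤ; -1ℤ) renaming (_*_ to _*ℤ_)
import Data.Integer.Properties as ℤP
open import Data.Maybe.Base using (Maybe; just; nothing)
open import Data.Nat as ℕ using (ℕ; zero; suc; _≤_; _<_; _∸_; z≤n; s≤s)
import Data.Nat.Properties as ℕP
open import Data.Nat.Solver using (module +-*-Solver)
open import Data.Product using (_×_; _,_; ∃-syntax)
open import Data.Sum using (inj₁; inj₂)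
open import Defs
open import Level using (Level; 0ℓ)
open import Relation.Binary.Definitions using (tri<; tri≈; tri>)
import Relation.Binary.PropositionalEquality as ≡
open ≡ using (_≡_; _≢_)
import Relation.Binary.Reasoning.Setoid as SetoidReasoning
open import Relation.Nullary using (¬_; Dec; yes; no; does; contradiction)
open import Relation.Nullary.Decidable using (isYes≗does; dec-true; dec-false)

-- The coefficients are those that evaluation in q dictates. At q = 1 every factor of the product
-- equals 1, which accounts for the leading 1 and for the factor 2 - q - q⁻¹. At q = t^k, a zero of
-- D_k, each other D_j is (1 - t^{j+k})(1 - t^{j-k}); their product assembles into r_{N,k}, and the
-- negative exponents j - k with j < k, together with the value of 2 - q - q⁻¹ there, leave the sign
-- and the power of t. This argument lives in rational functions of q, so the code verifies the
-- answer by induction instead. The product has to be finite for that: the step from N to N + 1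
-- compares r_{N+1,k} with r_{N,k}, and in the limit there is nothing left to step through.
-- Everything happens modulo s^{n+1} for one fixed n. There s is nilpotent, so every inverse is a
-- finite geometric sum and convergence never arises. The ring has no q⁻¹, but it has q⁻¹ t = s;
-- hence 2 - q - q⁻¹ only occurs with a factor t, as `v`.

-- Ring normalisation with integer coefficients in any commutative ring.

module IntegerSolver {c ℓ : Level} (R : CommutativeRing c ℓ) where
  open CommutativeRing R
  open Multiples semiring using (×-homo-+; ×1-homo-*; 1+×) renaming (_×_ to _·_)
  open RingProperties ring using (-‿distribˡ-*; -‿distribʳ-*)
  open AbelianGroupProperties +-abelianGroup using (⁻¹-∙-comm; ⁻¹-involutive; ε⁻¹≈ε)
  open SetoidReasoning setoid

  embed : ℤ → Carrier
  embed (+ n)    = n · 1#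
  embed -[1+ n ] = - (suc n · 1#)

  embed-neg : ∀ i → embed (ℤ.- i) ≈ - embed i
  embed-neg (+ zero)  = sym ε⁻¹≈ε
  embed-neg (+ suc n) = refl
  embed-neg -[1+ n ]  = sym (⁻¹-involutive _)

  embed-⊖ : ∀ m n → embed (m ℤ.⊖ n) ≈ m · 1# - n · 1#
  embed-⊖ zero    zero    = sym (-‿inverseʳ 0#)
  embed-⊖ zero    (suc n) = sym (+-identityˡ _)
  embed-⊖ (suc m) zero    = sym (trans (+-congˡ ε⁻¹≈ε) (+-identityʳ _))
  embed-⊖ (suc m) (suc n) = begin
    embed (suc m ℤ.⊖ suc n)              ≡⟨ ≡.cong embed (ℤP.[1+m]⊖[1+n]≡m⊖n m n) ⟩
    embed (m ℤ.⊖ n)                      ≈⟨ embed-⊖ m n ⟩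
    m · 1# - n · 1#                      ≈⟨ +-congʳ (sym (+-identityˡ _)) ⟩
    0# + m · 1# - n · 1#                 ≈⟨ +-congʳ (+-congʳ (sym (-‿inverseʳ 1#))) ⟩
    1# - 1# + m · 1# - n · 1#            ≈⟨ +-congʳ (trans (+-assoc _ _ _) (trans (+-congˡ (+-comm _ _)) (sym (+-assoc _ _ _)))) ⟩
    1# + m · 1# - 1# - n · 1#            ≈⟨ +-assoc _ _ _ ⟩
    1# + m · 1# + (- 1# - n · 1#)        ≈⟨ +-cong (sym (1+× m 1#)) (trans (⁻¹-∙-comm _ _) (-‿cong (sym (1+× n 1#)))) ⟩
    suc m · 1# - suc n · 1#              ∎

  embed-+ : ∀ i j → embed (i ℤ.+ j) ≈ embed i + embed j
  embed-+ (+ m)    (+ n)    = ×-homo-+ 1# m n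
  embed-+ (+ m)    -[1+ n ] = embed-⊖ m (suc n)
  embed-+ -[1+ m ] (+ n)    = trans (embed-⊖ n (suc m)) (+-comm _ _)
  embed-+ -[1+ m ] -[1+ n ] = begin
    - (suc (suc (m ℕ.+ n)) · 1#)      ≡⟨ ≡.cong (λ k → - (suc k · 1#)) (≡.sym (ℕP.+-suc m n)) ⟩
    - ((suc m ℕ.+ suc n) · 1#)        ≈⟨ -‿cong (×-homo-+ 1# (suc m) (suc n)) ⟩
    - (suc m · 1# + suc n · 1#)       ≈⟨ sym (⁻¹-∙-comm _ _) ⟩
    - (suc m · 1#) - suc n · 1#       ∎

  embed-*⁺ : ∀ m n → embed (+ m ℤ.* + n) ≈ embed (+ m) * embed (+ n)
  embed-*⁺ m n = trans (reflexive (≡.cong embed (≡.sym (ℤP.pos-* m n)))) (×1-homo-* m n)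

  embed-*ʳ : ∀ m j → embed (+ m ℤ.* j) ≈ embed (+ m) * embed j
  embed-*ʳ m (+ n)    = embed-*⁺ m n
  embed-*ʳ m -[1+ n ] = begin
    embed (+ m ℤ.* -[1+ n ])             ≡⟨ ≡.cong embed (≡.sym (ℤP.neg-distribʳ-* (+ m) (+ suc n))) ⟩
    embed (ℤ.- (+ m ℤ.* + suc n))        ≈⟨ embed-neg (+ m ℤ.* + suc n) ⟩
    - embed (+ m ℤ.* + suc n)            ≈⟨ -‿cong (embed-*⁺ m (suc n)) ⟩
    - (embed (+ m) * embed (+ suc n))    ≈⟨ -‿distribʳ-* _ _ ⟩
    embed (+ m) * embed -[1+ n ]         ∎

  embed-* : ∀ i j → embed (i ℤ.* j) ≈ embed i * embed j
  embed-* (+ m)    j = embed-*ʳ m j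
  embed-* -[1+ m ] j = begin
    embed (-[1+ m ] ℤ.* j)            ≡⟨ ≡.cong embed (≡.sym (ℤP.neg-distribˡ-* (+ suc m) j)) ⟩
    embed (ℤ.- (+ suc m ℤ.* j))       ≈⟨ embed-neg (+ suc m ℤ.* j) ⟩
    - embed (+ suc m ℤ.* j)           ≈⟨ -‿cong (embed-*ʳ (suc m) j) ⟩
    - (embed (+ suc m) * embed j)     ≈⟨ -‿distribˡ-* _ _ ⟩
    embed -[1+ m ] * embed j          ∎

  ℤ-rawRing : RawRing 0ℓ 0ℓ
  ℤ-rawRing = CommutativeRing.rawRing ℤP.+-*-commutativeRing

  embedding : ℤ-rawRing -Raw-AlmostCommutative⟶ fromCommutativeRing R
  embedding = record
    { ⟦_⟧    = embed
    ; +-homo = embed-+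
    ; *-homo = embed-*
    ; -‿homo = embed-neg
    ; 0-homo = refl
    ; 1-homo = refl
    }

  -- Equality in `R` need not be decidable; the normaliser only has to recognise equal coefficients,
  -- and those are compared as integers.
  embed-≟ : ∀ i j → Maybe (embed i ≈ embed j)
  embed-≟ i j with i ℤ.≟ j
  ... | yes i≡j = just (reflexive (≡.cong embed i≡j))
  ... | no  _   = nothing

  open RingSolver ℤ-rawRing (fromCommutativeRing R) embedding embed-≟ public
    using (solve; _:=_; _:+_; _:*_; _:-_; :-_; con)

-- Finite sums and the finite geometric series.

module FiniteSums {c ℓ : Level} (R : CommutativeRing c ℓ) where
  open CommutativeRing R
  open Exp commutativeSemiring using (_^_)
  open IntegerSolver R

  -- The bound is exclusive, unlike that of `sumTo`, so that the empty sum can start the induction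
  -- over partial sums.
  ∑ : ℕ → (ℕ → Carrier) → Carrier
  ∑ zero    f = 0#
  ∑ (suc n) f = ∑ n f + f n

  ∑-cong : ∀ n {f g} → (∀ k → f k ≈ g k) → ∑ n f ≈ ∑ n g
  ∑-cong zero    f≈g = refl
  ∑-cong (suc n) f≈g = +-cong (∑-cong n f≈g) (f≈g n)

  *-distribˡ-∑ : ∀ n x f → x * ∑ n f ≈ ∑ n (λ k → x * f k)
  *-distribˡ-∑ zero    x f = zeroʳ x
  *-distribˡ-∑ (suc n) x f = trans (distribˡ _ _ _) (+-congʳ (*-distribˡ-∑ n x f))

  ∑-distrib-- : ∀ n f g → ∑ n (λ k → f k - g k) ≈ ∑ n f - ∑ n g
  ∑-distrib-- zero    f g = sym (-‿inverseʳ 0#)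
  ∑-distrib-- (suc n) f g = trans (+-congʳ (∑-distrib-- n f g))
    (solve 4 (λ x y f g → x :- y :+ (f :- g) := x :+ f :- (y :+ g)) refl _ _ _ _)

  ∑-geometric : ∀ n x → (1# - x) * ∑ n (x ^_) ≈ 1# - x ^ n
  ∑-geometric zero    x = trans (zeroʳ _) (sym (-‿inverseʳ 1#))
  ∑-geometric (suc n) x = trans (distribˡ _ _ _) (trans (+-congʳ (∑-geometric n x))
    (solve 2 (λ x p → (con (+ 1) :- p) :+ (con (+ 1) :- x) :* p := con (+ 1) :- x :* p) refl x (x ^ n)))

-- The partial fraction identity over a ring with nilpotent s.

triangular : ℕ → ℕ
triangular zero    = 0
triangular (suc k) = triangular k ℕ.+ suc k

-- M a b stands for s^a q^b in a quotient of ℤ[q][[s]] where s^{n+1} = 0; t = q s.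
module PartialFractions
  {c ℓ : Level} (R : CommutativeRing c ℓ) (n : ℕ)
  (M : ℕ → ℕ → CommutativeRing.Carrier R)
  (M-one : CommutativeRing._≈_ R (M 0 0) (CommutativeRing.1# R))
  (M-* : ∀ a b a′ b′ → CommutativeRing._≈_ R (CommutativeRing._*_ R (M a b) (M a′ b′)) (M (a ℕ.+ a′) (b ℕ.+ b′)))
  (M-zero : ∀ a b → n < a → CommutativeRing._≈_ R (M a b) (CommutativeRing.0# R))
  where

  open CommutativeRing R
  open Exp commutativeSemiring using (_^_; ^-distrib-*; ^-congˡ)
  open IntegerSolver R
  open FiniteSums R
  open RingProperties ring using (-0#≈0#)
  open SetoidReasoning setoid

  M-≡ : ∀ {a b a′ b′} → a ≡ a′ → b ≡ b′ → M a b ≈ M a′ b′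
  M-≡ p q = reflexive (≡.cong₂ M p q)

  M-^ : ∀ a b m → M a b ^ m ≈ M (m ℕ.* a) (m ℕ.* b)
  M-^ a b zero    = sym M-one
  M-^ a b (suc m) = trans (*-congˡ (M-^ a b m)) (M-* a b _ _)

  geo : Carrier → Carrier
  geo x = ∑ (suc n) (x ^_)

  geo-inverse : ∀ x → x ^ suc n ≈ 0# → (1# - x) * geo x ≈ 1#
  geo-inverse x xⁿ⁺¹≈0 = begin
    (1# - x) * geo x    ≈⟨ ∑-geometric (suc n) x ⟩
    1# - x ^ suc n      ≈⟨ +-congˡ (trans (-‿cong xⁿ⁺¹≈0) -0#≈0#) ⟩
    1# + 0#             ≈⟨ +-identityʳ 1# ⟩
    1#                  ∎

  nilpotent : ∀ x y m → n < m → x ≈ M 1 0 * y → x ^ m ≈ 0#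
  nilpotent x y m n<m x≈sy = begin
    x ^ m                           ≈⟨ ^-congˡ m x≈sy ⟩
    (M 1 0 * y) ^ m                 ≈⟨ ^-distrib-* (M 1 0) y m ⟩
    M 1 0 ^ m * y ^ m               ≈⟨ *-congʳ (M-^ 1 0 m) ⟩
    M (m ℕ.* 1) (m ℕ.* 0) * y ^ m   ≈⟨ *-congʳ (M-zero _ _ (≡.subst (n <_) (≡.sym (ℕP.*-identityʳ m)) n<m)) ⟩
    0# * y ^ m                      ≈⟨ zeroˡ _ ⟩
    0#                              ∎

  geo-M-inverse : ∀ a b → (1# - M (suc a) b) * geo (M (suc a) b) ≈ 1#
  geo-M-inverse a b = geo-inverse _ (nilpotent _ (M a b) (suc n) ℕP.≤-refl (sym (M-* 1 0 a b)))

  -- In the notation of power series in t, T k, A m and B m are t^k, q t^k and q⁻¹ t^k,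
  -- the last two for k = m + 1.
  T : ℕ → Carrier
  T k = M k k

  T-* : ∀ a b → T a * T b ≈ T (a ℕ.+ b)
  T-* a b = M-* a a b b

  A B H d : ℕ → Carrier
  A m = M (suc m) (2 ℕ.+ m)
  B m = M (suc m) m
  -- `1# - H m` is D_{m+1} and `d m` its inverse. `H m` is spelled exactly like the argument of
  -- `geom` in `factor (suc m)`, so that the two agree by computation.
  H m = A m + B m - M (2 ℕ.* suc m) (2 ℕ.* suc m)
  d m = geo (H m)

  H-nilpotent : ∀ m k → n < k → H m ^ k ≈ 0#
  -- The cofactor of s in `H m`; `m + (suc m + 0)` is what remains of `2 * suc m` after one `suc` is
  -- taken off.
  H-nilpotent m k n<k = nilpotent (H m) (M m (2 ℕ.+ m) + M m m - M (m ℕ.+ (suc m ℕ.+ 0)) (2 ℕ.* suc m)) k n<k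
    (trans (+-cong (+-cong (sym (M-* 1 0 _ _)) (sym (M-* 1 0 _ _))) (-‿cong (sym (M-* 1 0 _ _))))
      (solve 4 (λ s x y z → s :* x :+ s :* y :- s :* z := s :* (x :+ y :- z)) refl _ _ _ _))

  d-inverse : ∀ m → (1# - H m) * d m ≈ 1#
  d-inverse m = geo-inverse _ (H-nilpotent m (suc n) ℕP.≤-refl)

  T-double : ∀ m → M (2 ℕ.* m) (2 ℕ.* m) ≈ T m * T m
  T-double m = trans (M-≡ (≡.cong (m ℕ.+_) (ℕP.+-identityʳ m)) (≡.cong (m ℕ.+_) (ℕP.+-identityʳ m))) (sym (T-* m m))

  A*B≈T*T : ∀ m → A m * B m ≈ T (suc m) * T (suc m)
  A*B≈T*T m = trans (M-* _ _ _ _) (trans (M-≡ ≡.refl (≡.cong suc (≡.sym (ℕP.+-suc m m)))) (sym (T-* _ _)))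

  I : ℕ → Carrier
  I m = geo (T (suc m))

  I-inverse : ∀ m → (1# - T (suc m)) * I m ≈ 1#
  I-inverse m = geo-M-inverse m (suc m)

  -- ∏_{i=1}^k (1 - t^{N-k+i}) / (1 - t^{N+i}), that is (t)_N² / ((t)_{N-k} (t)_{N+k})
  -- for k ≤ N, and 0 for k > N thanks to the factor 1 - t^{N∸N}.
  r : ℕ → ℕ → Carrier
  r N zero    = 1#
  r N (suc k) = r N k * (1# - T (N ∸ k)) * I (N ℕ.+ k)

  r-step : ∀ N k → (1# - T (N ∸ k)) * r N k ≈ (1# - T (suc (N ℕ.+ k))) * r N (suc k)
  r-step N k = begin
    (1# - T (N ∸ k)) * r N k
      ≈⟨ *-identityˡ _ ⟨
    1# * ((1# - T (N ∸ k)) * r N k)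
      ≈⟨ *-congʳ (I-inverse (N ℕ.+ k)) ⟨
    (1# - T (suc (N ℕ.+ k))) * I (N ℕ.+ k) * ((1# - T (N ∸ k)) * r N k)
      ≈⟨ solve 4 (λ z i g x → z :* i :* (g :* x) := z :* (x :* g :* i)) refl _ _ _ _ ⟩
    (1# - T (suc (N ℕ.+ k))) * r N (suc k) ∎

  -- For k ≤ N both sides are (t)_{N+1}² / ((t)_{N-k} (t)_{N+k}). Since `r` is built factor by
  -- factor, the proof is an induction on k through `r-step`.
  r-descend : ∀ N k → (1# - T (suc N ∸ k)) * (1# - T (suc N ℕ.+ k)) * r (suc N) k
                    ≈ (1# - T (suc N)) * (1# - T (suc N)) * r N k
  r-descend N zero    = *-congʳ (*-congˡ (+-congˡ (-‿cong (M-≡ N+0≡N N+0≡N))))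
    where N+0≡N = ℕP.+-identityʳ (suc N)
  r-descend N (suc k) = begin
    x * z * r (suc N) (suc k)
      ≈⟨ trans (*-congʳ (*-congˡ (+-congˡ (-‿cong (M-≡ (ℕP.+-suc (suc N) k) (ℕP.+-suc (suc N) k)))))) (*-assoc _ _ _) ⟩
    x * ((1# - T (suc (suc N ℕ.+ k))) * r (suc N) (suc k))
      ≈⟨ *-congˡ (r-step (suc N) k) ⟨
    x * (g * ρ)
      ≈⟨ *-congˡ (*-congˡ (*-identityˡ ρ)) ⟨
    x * (g * (1# * ρ))
      -- Inserts 1 = `y * i`: `y` completes the left side of the induction hypothesis, and `i`
      -- becomes the last factor of `r N (suc k)`.
      ≈⟨ *-congˡ (*-congˡ (*-congʳ (I-inverse (N ℕ.+ k)))) ⟨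
    x * (g * (y * i * ρ))
      ≈⟨ solve 5 (λ x g y i ρ → x :* (g :* (y :* i :* ρ)) := (g :* y :* ρ) :* x :* i) refl x g y i ρ ⟩
    (g * y * ρ) * x * i
      ≈⟨ *-congʳ (*-congʳ (r-descend N k)) ⟩
    (w * w * r N k) * x * i
      ≈⟨ solve 4 (λ w ρ x i → (w :* w :* ρ) :* x :* i := w :* w :* (ρ :* x :* i)) refl w (r N k) x i ⟩
    w * w * r N (suc k) ∎
    where
    x = 1# - T (N ∸ k)
    z = 1# - T (suc N ℕ.+ suc k)
    g = 1# - T (suc N ∸ k)
    y = 1# - T (suc (N ℕ.+ k))
    i = I (N ℕ.+ k)
    w = 1# - T (suc N)
    ρ = r (suc N) k

  r-vanishes : ∀ N → r N (suc N) ≈ 0#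
  r-vanishes N = trans (*-congʳ (trans (*-congˡ 1-T[N∸N]≈0) (zeroʳ _))) (zeroˡ _)
    where
    1-T[N∸N]≈0 : 1# - T (N ∸ N) ≈ 0#
    1-T[N∸N]≈0 = trans (+-congˡ (-‿cong (trans (M-≡ (ℕP.n∸n≡0 N) (ℕP.n∸n≡0 N)) M-one))) (-‿inverseʳ 1#)

  ε : ℕ → Carrier
  ε zero    = 1#
  ε (suc k) = - ε k

  -- t (2 - q - q⁻¹)
  v : Carrier
  v = M 1 1 + M 1 1 - (M 1 2 + M 1 0)

  v*T : ∀ m → v * T m ≈ T (suc m) + T (suc m) - (A m + B m)
  v*T m = trans
    (solve 4 (λ x a b y → (x :+ x :- (a :+ b)) :* y := x :* y :+ x :* y :- (a :* y :+ b :* y)) refl _ _ _ _)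
    (+-cong (+-cong (M-* _ _ _ _) (M-* _ _ _ _)) (-‿cong (+-cong (M-* _ _ _ _) (M-* _ _ _ _))))

  coefficient : ℕ → Carrier
  coefficient m = ε (suc m) * T (triangular m) * (1# + T (suc m)) * (v * T m)

  -- The cut-off `m` is kept apart from `N`, so that the passage from N to N + 1 can be proved by
  -- induction on the number of terms.
  S : ℕ → ℕ → Carrier
  S N m = 1# + ∑ m (λ k → coefficient k * r N (suc k) * d k)

  -- Multiplying the term of 1/D_k by D_{N+1} = x D_k + (1 - x)(1 - z), where x = t^{N+1-k} and z =
  -- t^{N+1+k}, splits it in two. In the second part `r-descend` turns the term for N + 1 into the
  -- one for N; in the first the denominator cancels, and what is left telescopes into the closed
  -- remainder on the right.
  S-descend : ∀ N m → m ≤ suc N →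
    (1# - H N) * S (suc N) m
      ≈ (1# - T (suc N)) * (1# - T (suc N)) * S N m
        + v * T N * (ε m * T (triangular m) * ((1# - T (suc N ∸ m)) * r (suc N) m) * I N)
  S-descend N zero _ = begin
    (1# - H N) * (1# + 0#)
      ≈⟨ *-congʳ (+-congˡ (-‿cong (+-congˡ (-‿cong (T-double (suc N)))))) ⟩
    (1# - (A N + B N - w * w)) * (1# + 0#)
      -- The remainder starts from D_{N+1} = (1 - t^{N+1})² + t^{N+1} (2 - q - q⁻¹).
      ≈⟨ solve 3 (λ a b w → (con (+ 1) :- (a :+ b :- w :* w)) :* (con (+ 1) :+ con (+ 0))
            := (con (+ 1) :- w) :* (con (+ 1) :- w) :* (con (+ 1) :+ con (+ 0)) :+ (w :+ w :- (a :+ b))) refl (A N) (B N) w ⟩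
    (1# - w) * (1# - w) * (1# + 0#) + (w + w - (A N + B N))
      ≈⟨ +-congˡ (v*T N) ⟨
    (1# - w) * (1# - w) * (1# + 0#) + v * T N
      ≈⟨ +-congˡ (*-identityʳ _) ⟨
    (1# - w) * (1# - w) * (1# + 0#) + v * T N * 1#
      ≈⟨ +-congˡ (*-congˡ (I-inverse N)) ⟨
    (1# - w) * (1# - w) * (1# + 0#) + v * T N * ((1# - w) * I N)
      ≈⟨ +-congˡ (*-congˡ (*-congʳ (solve 1 (λ w → con (+ 1) :- w := con (+ 1) :* con (+ 1) :* ((con (+ 1) :- w) :* con (+ 1))) refl w))) ⟩
    (1# - w) * (1# - w) * (1# + 0#) + v * T N * (1# * 1# * ((1# - w) * 1#) * I N)
      ≈⟨ +-congˡ (*-congˡ (*-congʳ (*-congʳ (*-congˡ M-one)))) ⟨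
    (1# - w) * (1# - w) * (1# + 0#) + v * T N * (1# * M 0 0 * ((1# - w) * 1#) * I N) ∎
    where w = T (suc N)
  S-descend N (suc m) (s≤s m≤N) = begin
    DN * (1# + (Σ₁ + γ * ρ * δ))
      ≈⟨ solve 5 (λ D σ γ ρ δ → D :* (con (+ 1) :+ (σ :+ γ :* ρ :* δ)) := D :* (con (+ 1) :+ σ) :+ γ :* ρ :* δ :* D) refl DN Σ₁ γ ρ δ ⟩
    DN * (1# + Σ₁) + γ * ρ * δ * DN
      ≈⟨ +-cong (S-descend N m (ℕP.m≤n⇒m≤1+n m≤N)) (*-congˡ DN-split) ⟩
    W * (1# + Σ₀) + v * T N * (e * p * ((1# - T (suc N ∸ m)) * r (suc N) m) * i)
      + γ * ρ * δ * (x * Dm + (1# - x) * (1# - z))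
      ≈⟨ +-congʳ (+-congˡ (*-congˡ (*-congʳ (*-congˡ (trans (r-step (suc N) m) (*-congʳ (+-congˡ (-‿cong z-eq)))))))) ⟩
    W * (1# + Σ₀) + v * T N * (e * p * ((1# - z) * ρ) * i)
      + γ * ρ * δ * (x * Dm + (1# - x) * (1# - z))
      ≈⟨ solve 12 (λ W Σ₀ vT e p z ρ i γ δ x Dm →
            W :* (con (+ 1) :+ Σ₀) :+ vT :* (e :* p :* ((con (+ 1) :- z) :* ρ) :* i) :+ γ :* ρ :* δ :* (x :* Dm :+ (con (+ 1) :- x) :* (con (+ 1) :- z))
            := W :* (con (+ 1) :+ Σ₀) :+ vT :* (e :* p :* ((con (+ 1) :- z) :* ρ) :* i) :+ x :* γ :* ρ :* (Dm :* δ) :+ γ :* δ :* ((con (+ 1) :- x) :* (con (+ 1) :- z) :* ρ))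
            refl W Σ₀ (v * T N) e p z ρ i γ δ x Dm ⟩
    W * (1# + Σ₀) + v * T N * (e * p * ((1# - z) * ρ) * i)
      + x * γ * ρ * (Dm * δ) + γ * δ * ((1# - x) * (1# - z) * ρ)
      -- The cancelled `Dm * δ` = 1 is written as `(1# - w) * i`, to share the factor `i` with the
      -- remainder.
      ≈⟨ +-cong (+-congˡ (*-congˡ (trans (d-inverse m) (sym (I-inverse N))))) (*-congˡ (r-descend-at)) ⟩
    W * (1# + Σ₀) + v * T N * (e * p * ((1# - z) * ρ) * i)
      + x * γ * ρ * ((1# - w) * i) + γ * δ * (W * ρ₀)
      ≈⟨ +-congʳ (+-cong (+-congˡ (*-cong vTN (*-congʳ (*-congˡ (*-congʳ (+-congˡ (-‿cong z-prod))))))) (*-congˡ (*-congʳ (+-congˡ (-‿cong w-prod))))) ⟩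
    W * (1# + Σ₀) + x * (v * T m) * (e * p * ((1# - x * y * y) * ρ) * i)
      + x * γ * ρ * ((1# - x * y) * i) + γ * δ * (W * ρ₀)
      -- The telescoping: (1 - x y²) - (1 + y)(1 - x y) = - y (1 - x) turns the old remainder and
      -- the cancelled part into the next remainder, with sign - e and power p y.
      ≈⟨ solve 11 (λ W Σ₀ x vt e p y ρ i δ ρ₀ →
            W :* (con (+ 1) :+ Σ₀) :+ x :* vt :* (e :* p :* ((con (+ 1) :- x :* y :* y) :* ρ) :* i)
              :+ x :* (:- e :* p :* (con (+ 1) :+ y) :* vt) :* ρ :* ((con (+ 1) :- x :* y) :* i)
              :+ (:- e :* p :* (con (+ 1) :+ y) :* vt) :* δ :* (W :* ρ₀)
            := W :* (con (+ 1) :+ (Σ₀ :+ (:- e :* p :* (con (+ 1) :+ y) :* vt) :* ρ₀ :* δ))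
              :+ x :* vt :* (:- e :* (p :* y) :* ((con (+ 1) :- x) :* ρ) :* i))
            refl W Σ₀ x (v * T m) e p y ρ i δ ρ₀ ⟩
    W * (1# + (Σ₀ + γ * ρ₀ * δ)) + x * (v * T m) * (- e * (p * y) * ((1# - x) * ρ) * i)
      ≈⟨ +-congˡ (*-cong (sym vTN) (*-congʳ (*-congʳ (*-congˡ (T-* _ _))))) ⟩
    W * (1# + (Σ₀ + γ * ρ₀ * δ)) + v * T N * (- e * T (triangular (suc m)) * ((1# - x) * ρ) * i) ∎
    where
    DN = 1# - H N
    Dm = 1# - H m
    W  = (1# - T (suc N)) * (1# - T (suc N))
    Σ₁ = ∑ m (λ k → coefficient k * r (suc N) (suc k) * d k)
    Σ₀ = ∑ m (λ k → coefficient k * r N (suc k) * d k)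
    γ  = coefficient m
    ρ  = r (suc N) (suc m)
    ρ₀ = r N (suc m)
    δ  = d m
    e  = ε m
    p  = T (triangular m)
    i  = I N
    x  = T (N ∸ m)
    y  = T (suc m)
    w  = T (suc N)
    z  = T (suc N ℕ.+ suc m)

    N∸m+m≡N : N ∸ m ℕ.+ m ≡ N
    N∸m+m≡N = ℕP.m∸n+n≡m m≤N

    N∸m+1+m≡1+N : N ∸ m ℕ.+ suc m ≡ suc N
    N∸m+1+m≡1+N = ≡.trans (ℕP.+-suc (N ∸ m) m) (≡.cong suc N∸m+m≡N)

    N∸m+2+m≡2+N : N ∸ m ℕ.+ (2 ℕ.+ m) ≡ 2 ℕ.+ N
    N∸m+2+m≡2+N = ≡.trans (ℕP.+-suc (N ∸ m) (suc m)) (≡.cong suc N∸m+1+m≡1+N)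

    w-prod : w ≈ x * y
    w-prod = sym (trans (T-* _ _) (M-≡ N∸m+1+m≡1+N N∸m+1+m≡1+N))

    z-prod : z ≈ x * y * y
    z-prod = trans (sym (T-* _ _)) (*-congʳ w-prod)

    z-eq : T (suc (suc N ℕ.+ m)) ≈ z
    z-eq = M-≡ (≡.sym (ℕP.+-suc (suc N) m)) (≡.sym (ℕP.+-suc (suc N) m))

    vTN : v * T N ≈ x * (v * T m)
    vTN = trans (*-congˡ (sym (trans (T-* (N ∸ m) m) (M-≡ N∸m+m≡N N∸m+m≡N))))
      (solve 3 (λ v x t → v :* (x :* t) := x :* (v :* t)) refl v x (T m))

    r-descend-at : (1# - x) * (1# - z) * ρ ≈ W * ρ₀
    r-descend-at = r-descend N (suc m)

    DN-split : DN ≈ x * Dm + (1# - x) * (1# - z)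
    DN-split = begin
      1# - (A N + B N - M (2 ℕ.* suc N) (2 ℕ.* suc N))
        ≈⟨ +-congˡ (-‿cong (+-cong (+-cong
             (sym (trans (M-* _ _ _ _) (M-≡ N∸m+1+m≡1+N N∸m+2+m≡2+N)))
             (sym (trans (M-* _ _ _ _) (M-≡ N∸m+1+m≡1+N N∸m+m≡N))))
             (-‿cong (trans (T-double (suc N)) (*-cong w-prod w-prod))))) ⟩
      1# - (x * A m + x * B m - x * y * (x * y))
        ≈⟨ solve 4 (λ x a b y → con (+ 1) :- (x :* a :+ x :* b :- x :* y :* (x :* y))
             := x :* (con (+ 1) :- (a :+ b :- y :* y)) :+ (con (+ 1) :- x) :* (con (+ 1) :- x :* y :* y)) refl x (A m) (B m) y ⟩
      x * (1# - (A m + B m - y * y)) + (1# - x) * (1# - x * y * y)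
        ≈⟨ +-cong (*-congˡ (+-congˡ (-‿cong (+-congˡ (-‿cong (sym (T-double (suc m)))))))) (*-congˡ (+-congˡ (-‿cong (sym z-prod)))) ⟩
      x * Dm + (1# - x) * (1# - z) ∎

  -- At m = N + 1 the remainder of `S-descend` contains 1 - t^0 = 0, and the surplus last term of
  -- `S N (suc N)` is void by `r-vanishes`.
  S-step : ∀ N → S (suc N) (suc N) ≈ S N N * ((1# - T (suc N)) * (1# - T (suc N)) * d N)
  S-step N = begin
    S (suc N) (suc N)
      ≈⟨ *-identityʳ _ ⟨
    S (suc N) (suc N) * 1#
      ≈⟨ *-congˡ (d-inverse N) ⟨
    S (suc N) (suc N) * ((1# - H N) * d N)
      ≈⟨ solve 3 (λ s h d → s :* (h :* d) := h :* s :* d) refl _ _ _ ⟩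
    (1# - H N) * S (suc N) (suc N) * d N
      ≈⟨ *-congʳ (S-descend N (suc N) ℕP.≤-refl) ⟩
    (W * S N (suc N) + v * T N * (e * p * ((1# - T (N ∸ N)) * ρ) * i)) * d N
      ≈⟨ *-congʳ (+-cong (*-congˡ S-stable) (*-congˡ (*-congʳ (*-congˡ (*-congʳ (+-congˡ (-‿cong T[N∸N]≈1))))))) ⟩
    (W * S N N + v * T N * (e * p * ((1# - 1#) * ρ) * i)) * d N
      ≈⟨ solve 7 (λ W s x y ρ i d → (W :* s :+ x :* (y :* ((con (+ 1) :- con (+ 1)) :* ρ) :* i)) :* d := s :* (W :* d)) refl
           W (S N N) (v * T N) (e * p) ρ i (d N) ⟩
    S N N * (W * d N) ∎
    where
    W = (1# - T (suc N)) * (1# - T (suc N))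
    e = ε (suc N)
    p = T (triangular (suc N))
    ρ = r (suc N) (suc N)
    i = I N

    T[N∸N]≈1 : T (N ∸ N) ≈ 1#
    T[N∸N]≈1 = trans (M-≡ (ℕP.n∸n≡0 N) (ℕP.n∸n≡0 N)) M-one

    S-stable : S N (suc N) ≈ S N N
    S-stable = +-congˡ (trans (+-congˡ (trans (*-congʳ (trans (*-congˡ (r-vanishes N)) (zeroʳ _))) (zeroˡ _))) (+-identityʳ _))

  P : ℕ → Carrier
  P zero    = 1#
  P (suc N) = P N * ((1# - T (suc N)) * (1# - T (suc N)) * d N)

  P≈S : ∀ N → P N ≈ S N N
  P≈S zero    = sym (+-identityʳ 1#)
  P≈S (suc N) = trans (*-congʳ (P≈S N)) (sym (S-step N))

  -- Disappearance of r modulo s^{n+1}, and the split into two geometric series.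

  M*T-absorbs : ∀ a b m → n < a ℕ.+ m → M a b * (1# - T m) ≈ M a b
  M*T-absorbs a b m n<a+m = begin
    M a b * (1# - T m)            ≈⟨ solve 2 (λ x y → x :* (con (+ 1) :- y) := x :- x :* y) refl _ _ ⟩
    M a b - M a b * T m           ≈⟨ +-congˡ (-‿cong (trans (M-* _ _ _ _) (M-zero _ _ n<a+m))) ⟩
    M a b - 0#                    ≈⟨ +-congˡ -0#≈0# ⟩
    M a b + 0#                    ≈⟨ +-identityʳ _ ⟩
    M a b                         ∎

  M*r-absorbs : ∀ a b k → k ≤ a → M a b * r n k ≈ M a b
  M*r-absorbs a b zero    _   = *-identityʳ _
  M*r-absorbs a b (suc k) k<a = begin
    M a b * (r n k * (1# - T (n ∸ k)) * I (n ℕ.+ k))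
      ≈⟨ solve 4 (λ m r x i → m :* (r :* x :* i) := (m :* r) :* x :* i) refl _ _ _ _ ⟩
    M a b * r n k * (1# - T (n ∸ k)) * I (n ℕ.+ k)
      ≈⟨ *-congʳ (*-congʳ (M*r-absorbs a b k (ℕP.<⇒≤ k<a))) ⟩
    M a b * (1# - T (n ∸ k)) * I (n ℕ.+ k)
      ≈⟨ *-congʳ (M*T-absorbs a b (n ∸ k) (ℕP.≤-<-trans (ℕP.m≤n+m∸n n k) (ℕP.+-monoˡ-< (n ∸ k) k<a))) ⟩
    M a b * I (n ℕ.+ k)
      -- The inverse is removed by first inserting its denominator, which acts as 1 on `M a b`.
      ≈⟨ *-congʳ (M*T-absorbs a b (suc (n ℕ.+ k)) (ℕP.≤-trans (s≤s (ℕP.m≤m+n n k)) (ℕP.m≤n+m _ a))) ⟨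
    M a b * (1# - T (suc (n ℕ.+ k))) * I (n ℕ.+ k)
      ≈⟨ trans (*-assoc _ _ _) (*-congˡ (I-inverse (n ℕ.+ k))) ⟩
    M a b * 1#
      ≈⟨ *-identityʳ _ ⟩
    M a b ∎

  -- Once `v * T k` is expanded, each of its monomials has s-exponent k + 1, exactly what
  -- `M*r-absorbs` asks for `r n (suc k)`.
  coefficient-absorbs : ∀ k → coefficient k * r n (suc k) ≈ coefficient k
  coefficient-absorbs k = begin
    ε (suc k) * T (triangular k) * (1# + T (suc k)) * (v * T k) * r n (suc k)
      ≈⟨ *-congʳ (*-congˡ (v*T k)) ⟩
    ε (suc k) * T (triangular k) * (1# + T (suc k)) * (T (suc k) + T (suc k) - (A k + B k)) * r n (suc k)
      ≈⟨ solve 5 (λ e t a b r → e :* (t :+ t :- (a :+ b)) :* r := e :* (t :* r :+ t :* r :- (a :* r :+ b :* r))) refl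
           (ε (suc k) * T (triangular k) * (1# + T (suc k))) (T (suc k)) (A k) (B k) (r n (suc k)) ⟩
    ε (suc k) * T (triangular k) * (1# + T (suc k))
      * (T (suc k) * r n (suc k) + T (suc k) * r n (suc k) - (A k * r n (suc k) + B k * r n (suc k)))
      ≈⟨ *-congˡ (+-cong (+-cong (absorb _) (absorb _)) (-‿cong (+-cong (absorb _) (absorb _)))) ⟩
    ε (suc k) * T (triangular k) * (1# + T (suc k)) * (T (suc k) + T (suc k) - (A k + B k))
      ≈⟨ *-congˡ (v*T k) ⟨
    coefficient k ∎
    where
    absorb : ∀ b → M (suc k) b * r n (suc k) ≈ M (suc k) b
    absorb b = M*r-absorbs (suc k) b (suc k) ℕP.≤-refl

  -- Because `A k * B k` is t^{2(k+1)}, `1# - H k` equals (1 - A)(1 - B), and inverses are unique.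
  d-factors : ∀ k → d k ≈ geo (A k) * geo (B k)
  d-factors k = begin
    d k
      ≈⟨ *-identityʳ _ ⟨
    d k * 1#
      ≈⟨ *-congˡ (trans (sym (*-identityʳ 1#)) (*-cong (sym (geo-M-inverse k (2 ℕ.+ k))) (sym (geo-M-inverse k k)))) ⟩
    d k * ((1# - A k) * geo (A k) * ((1# - B k) * geo (B k)))
      ≈⟨ solve 5 (λ d a α b β → d :* ((con (+ 1) :- a) :* α :* ((con (+ 1) :- b) :* β))
           := (con (+ 1) :- (a :+ b :- a :* b)) :* d :* (α :* β)) refl (d k) (A k) (geo (A k)) (B k) (geo (B k)) ⟩
    (1# - (A k + B k - A k * B k)) * d k * (geo (A k) * geo (B k))
      ≈⟨ *-congʳ (*-congʳ (+-congˡ (-‿cong (+-congˡ (-‿cong (trans (A*B≈T*T k) (sym (T-double (suc k))))))))) ⟩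
    (1# - H k) * d k * (geo (A k) * geo (B k))
      ≈⟨ *-congʳ (d-inverse k) ⟩
    1# * (geo (A k) * geo (B k))
      ≈⟨ *-identityˡ _ ⟩
    geo (A k) * geo (B k) ∎

  coefficient*d : ∀ k → coefficient k * d k
    ≈ ε (suc k) * (T (triangular k) * ((T (suc k) - A k) * geo (A k)) + T (triangular k) * ((T (suc k) - B k) * geo (B k)))
  coefficient*d k = begin
    ε (suc k) * p * (1# + y) * (v * T k) * d k
      ≈⟨ *-cong (*-congˡ (v*T k)) (d-factors k) ⟩
    ε (suc k) * p * (1# + y) * (y + y - (a + b)) * (α * β)
      ≈⟨ solve 7 (λ e p y a b α β → e :* p :* (con (+ 1) :+ y) :* (y :+ y :- (a :+ b)) :* (α :* β)
           := e :* p :* (y :+ y :- (a :+ b) :+ (y :* y :+ y :* y) :- y :* a :- y :* b) :* (α :* β)) refl (ε (suc k)) p y a b α β ⟩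
    ε (suc k) * p * (y + y - (a + b) + (y * y + y * y) - y * a - y * b) * (α * β)
      -- Replacing y² by a b makes (1 + y)(2y - a - b) equal to (y - a)(1 - b) + (y - b)(1 - a), so
      -- each summand loses one of the two denominators.
      ≈⟨ *-congʳ (*-congˡ (+-congʳ (+-congʳ (+-congˡ (+-cong (A*B≈T*T k) (A*B≈T*T k)))))) ⟨
    ε (suc k) * p * (y + y - (a + b) + (a * b + a * b) - y * a - y * b) * (α * β)
      ≈⟨ solve 7 (λ e p y a b α β → e :* p :* (y :+ y :- (a :+ b) :+ (a :* b :+ a :* b) :- y :* a :- y :* b) :* (α :* β)
           := e :* (p :* ((y :- a) :* α) :* ((con (+ 1) :- b) :* β) :+ p :* ((y :- b) :* β) :* ((con (+ 1) :- a) :* α))) refl (ε (suc k)) p y a b α β ⟩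
    ε (suc k) * (p * ((y - a) * α) * ((1# - b) * β) + p * ((y - b) * β) * ((1# - a) * α))
      ≈⟨ *-congˡ (+-cong (trans (*-congˡ (geo-M-inverse k k)) (*-identityʳ _)) (trans (*-congˡ (geo-M-inverse k (2 ℕ.+ k))) (*-identityʳ _))) ⟩
    ε (suc k) * (p * ((y - a) * α) + p * ((y - b) * β)) ∎
    where
    p = T (triangular k)
    y = T (suc k)
    a = A k
    b = B k
    α = geo a
    β = geo b

  -- t^{k(k+1)/2} (t^{k+1} - x) / (1 - x) for x = s^{k+1} q^b.
  branch : ℕ → ℕ → Carrier
  branch k b = ∑ (suc n) (λ m →
      M (triangular k ℕ.+ (suc k ℕ.+ m ℕ.* suc k)) (triangular k ℕ.+ (suc k ℕ.+ m ℕ.* b))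
    - M (triangular k ℕ.+ suc m ℕ.* suc k) (triangular k ℕ.+ suc m ℕ.* b))

  expand-branch : ∀ k b → T (triangular k) * ((T (suc k) - M (suc k) b) * geo (M (suc k) b)) ≈ branch k b
  expand-branch k b = begin
    p * ((y - x) * geo x)
      ≈⟨ *-congˡ (*-distribˡ-∑ (suc n) _ _) ⟩
    p * ∑ (suc n) (λ m → (y - x) * x ^ m)
      ≈⟨ *-distribˡ-∑ (suc n) _ _ ⟩
    ∑ (suc n) (λ m → p * ((y - x) * x ^ m))
      ≈⟨ ∑-cong (suc n) (λ m → trans
           (solve 4 (λ p y x q → p :* ((y :- x) :* q) := p :* (y :* q) :- p :* (x :* q)) refl p y x (x ^ m))
           (+-cong (trans (*-congˡ (trans (*-congˡ (M-^ _ _ m)) (M-* _ _ _ _))) (M-* _ _ _ _))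
                   (-‿cong (trans (*-congˡ (M-^ _ _ (suc m))) (M-* _ _ _ _))))) ⟩
    branch k b ∎
    where
    p = T (triangular k)
    y = T (suc k)
    x = M (suc k) b

  P-expansion : P n ≈ 1# + ∑ n (λ k → ε (suc k) * (branch k (2 ℕ.+ k) + branch k k))
  P-expansion = trans (P≈S n) (+-congˡ (∑-cong n (λ k → trans (*-congʳ (coefficient-absorbs k))
    (trans (coefficient*d k) (*-congˡ (+-cong (expand-branch k (2 ℕ.+ k)) (expand-branch k k)))))))

-- Cauchy products over a commutative ring.

module Convolution {c ℓ : Level} (A : CommutativeRing c ℓ) where
  open CommutativeRing A
  open SetoidReasoning setoid
  open IntegerSolver A

  Seq : Set c
  Seq = ℕ → Carrier

  tail : Seq → Seq
  tail f a = f (suc a)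

  monomial : ℕ → Carrier → Seq
  monomial zero    x zero    = x
  monomial zero    x (suc _) = 0#
  monomial (suc a) x zero    = 0#
  monomial (suc a) x (suc n) = monomial a x n

  -- Peels off the lowest coefficient of `f` instead of summing over index pairs: the ring laws
  -- become inductions on the index through `tail`, free of subtraction.
  conv : Seq → Seq → Seq
  conv f g zero    = f 0 * g 0
  conv f g (suc n) = f 0 * g (suc n) + conv (tail f) g n

  conv-cong-≤ : ∀ n {f f′ g g′} → (∀ a → a ≤ n → f a ≈ f′ a) → (∀ a → a ≤ n → g a ≈ g′ a) → conv f g n ≈ conv f′ g′ n
  conv-cong-≤ zero    p q = *-cong (p 0 z≤n) (q 0 z≤n)
  conv-cong-≤ (suc n) p q = +-cong (*-cong (p 0 z≤n) (q (suc n) ℕP.≤-refl))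
    (conv-cong-≤ n (λ a a≤n → p (suc a) (s≤s a≤n)) (λ a a≤n → q a (ℕP.m≤n⇒m≤1+n a≤n)))

  conv-distribʳ : ∀ n f g h → conv (λ a → f a + g a) h n ≈ conv f h n + conv g h n
  conv-distribʳ zero    f g h = distribʳ _ _ _
  conv-distribʳ (suc n) f g h = trans (+-congˡ (conv-distribʳ n (tail f) (tail g) h))
    (solve 5 (λ f g h x y → (f :+ g) :* h :+ (x :+ y) := f :* h :+ x :+ (g :* h :+ y)) refl _ _ _ _ _)

  conv-scale : ∀ n x g h → conv (λ a → x * g a) h n ≈ x * conv g h n
  conv-scale zero    x g h = *-assoc _ _ _
  conv-scale (suc n) x g h = trans (+-congˡ (conv-scale n x (tail g) h))
    (solve 4 (λ x g h y → x :* g :* h :+ x :* y := x :* (g :* h :+ y)) refl _ _ _ _)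

  conv-assoc : ∀ n f g h → conv (conv f g) h n ≈ conv f (conv g h) n
  conv-assoc zero    f g h = *-assoc _ _ _
  conv-assoc (suc n) f g h = begin
    f 0 * g 0 * h (suc n) + conv (λ a → f 0 * g (suc a) + conv (tail f) g a) h n
      ≈⟨ +-congˡ (trans (conv-distribʳ n _ _ h) (+-cong (conv-scale n (f 0) (tail g) h) (conv-assoc n (tail f) g h))) ⟩
    f 0 * g 0 * h (suc n) + (f 0 * conv (tail g) h n + conv (tail f) (conv g h) n)
      ≈⟨ solve 5 (λ f g h x y → f :* g :* h :+ (f :* x :+ y) := f :* (g :* h :+ x) :+ y) refl _ _ _ _ _ ⟩
    f 0 * (g 0 * h (suc n) + conv (tail g) h n) + conv (tail f) (conv g h) n ∎

  -- Mirrors the recursion on the right argument, which is what commutativity needs.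
  conv-sucʳ : ∀ n f g → conv f g (suc n) ≈ f (suc n) * g 0 + conv f (tail g) n
  conv-sucʳ zero    f g = +-comm _ _
  conv-sucʳ (suc n) f g = trans (+-congˡ (conv-sucʳ n (tail f) g))
    (solve 3 (λ x y z → x :+ (y :+ z) := y :+ (x :+ z)) refl _ _ _)

  conv-comm : ∀ n f g → conv f g n ≈ conv g f n
  conv-comm zero    f g = *-comm _ _
  conv-comm (suc n) f g = trans (+-cong (*-comm _ _) (conv-comm n (tail f) g)) (sym (conv-sucʳ n g f))

  conv-zeroˡ : ∀ n g → conv (λ _ → 0#) g n ≈ 0#
  conv-zeroˡ zero    g = zeroˡ _
  conv-zeroˡ (suc n) g = trans (+-cong (zeroˡ _) (conv-zeroˡ n g)) (+-identityˡ 0#)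

  conv-constantˡ : ∀ n x g → conv (monomial 0 x) g n ≈ x * g n
  conv-constantˡ zero    x g = refl
  conv-constantˡ (suc n) x g = trans (+-congˡ (conv-zeroˡ n g)) (+-identityʳ _)

  conv-identityˡ : ∀ n g → conv (monomial 0 1#) g n ≈ g n
  conv-identityˡ n g = trans (conv-constantˡ n 1# g) (*-identityˡ _)

  *-monomial : ∀ n b x y → x * monomial b y n ≈ monomial b (x * y) n
  *-monomial zero    zero    x y = refl
  *-monomial (suc n) zero    x y = zeroʳ x
  *-monomial zero    (suc b) x y = zeroʳ x
  *-monomial (suc n) (suc b) x y = *-monomial n b x y

  conv-monomial : ∀ n a b x y → conv (monomial a x) (monomial b y) n ≈ monomial (a ℕ.+ b) (x * y) n
  conv-monomial n       zero    b x y = trans (conv-constantˡ n x _) (*-monomial n b x y)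
  conv-monomial zero    (suc a) b x y = zeroˡ _
  conv-monomial (suc n) (suc a) b x y = trans (+-cong (zeroˡ _) (conv-monomial n a b x y)) (+-identityˡ _)

  monomial-cong : ∀ n a {x y} → x ≈ y → monomial a x n ≈ monomial a y n
  monomial-cong zero    zero    x≈y = x≈y
  monomial-cong (suc n) zero    x≈y = refl
  monomial-cong zero    (suc a) x≈y = refl
  monomial-cong (suc n) (suc a) x≈y = monomial-cong n a x≈y

  monomial-zero : ∀ n a x → n < a → monomial a x n ≈ 0#
  monomial-zero zero    (suc a) x _         = refl
  monomial-zero (suc n) (suc a) x (s≤s n<a) = monomial-zero n a x n<a

-- A[x]/(x^{N+1}), on all coefficient sequences with equality up to index N.
module TruncatedSeries {c ℓ : Level} (A : CommutativeRing c ℓ) (N : ℕ) where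
  open CommutativeRing A
  open Convolution A

  commutativeRing : CommutativeRing c ℓ
  commutativeRing = record
    { Carrier = Seq
    ; _≈_ = λ f g → ∀ a → a ≤ N → f a ≈ g a
    ; _+_ = λ f g a → f a + g a
    ; _*_ = conv
    ; -_ = λ f a → - f a
    ; 0# = λ _ → 0#
    ; 1# = monomial 0 1#
    ; isCommutativeRing = record
      { isRing = record
        { +-isAbelianGroup = record
          { isGroup = record
            { isMonoid = record
              { isSemigroup = record
                { isMagma = record
                  { isEquivalence = record
                    { refl  = λ _ _ → refl
                    ; sym   = λ p a a≤N → sym (p a a≤N)
                    ; trans = λ p q a a≤N → trans (p a a≤N) (q a a≤N)
                    }
                  ; ∙-cong = λ p q a a≤N → +-cong (p a a≤N) (q a a≤N)
                  }
                ; assoc = λ _ _ _ _ _ → +-assoc _ _ _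
                }
              ; identity = (λ _ _ _ → +-identityˡ _) , (λ _ _ _ → +-identityʳ _)
              }
            ; inverse = (λ _ _ _ → -‿inverseˡ _) , (λ _ _ _ → -‿inverseʳ _)
            ; ⁻¹-cong = λ p a a≤N → -‿cong (p a a≤N)
            }
          ; comm = λ _ _ _ _ → +-comm _ _
          }
        ; *-cong = λ p q a a≤N → conv-cong-≤ a (λ b b≤a → p b (ℕP.≤-trans b≤a a≤N)) (λ b b≤a → q b (ℕP.≤-trans b≤a a≤N))
        ; *-assoc = λ f g h a _ → conv-assoc a f g h
        ; *-identity = (λ g a _ → conv-identityˡ a g) , (λ g a _ → trans (conv-comm a g (monomial 0 1#)) (conv-identityˡ a g))
        ; distrib = (λ f g h a _ → trans (conv-comm a f _) (trans (conv-distribʳ a g h f) (+-cong (conv-comm a g f) (conv-comm a h f))))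
                  , (λ h f g a _ → conv-distribʳ a f g h)
        }
      ; *-comm = λ f g a _ → conv-comm a f g
      }
    }

-- From the given series operations to the truncated ring.

open import Data.Nat using (_+_; _*_; _≟_)

ℤ-ring : CommutativeRing 0ℓ 0ℓ
ℤ-ring = ℤP.+-*-commutativeRing

open FiniteSums ℤ-ring using () renaming (∑ to ∑ℤ; ∑-cong to ∑ℤ-cong; ∑-distrib-- to ∑ℤ-distrib--)
open Convolution using (conv; monomial)

q-ring : ℕ → CommutativeRing 0ℓ 0ℓ
q-ring J = TruncatedSeries.commutativeRing ℤ-ring J

sumTo-cong : ∀ n {f g} → (∀ k → f k ≡ g k) → sumTo n f ≡ sumTo n g
sumTo-cong zero    f≡g = f≡g 0
sumTo-cong (suc n) f≡g = ≡.cong₂ ℤ._+_ (sumTo-cong n f≡g) (f≡g (suc n))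

sumTo-front : ∀ n f → sumTo (suc n) f ≡ f 0 ℤ.+ sumTo n (λ k → f (suc k))
sumTo-front zero    f = ≡.refl
sumTo-front (suc n) f = ≡.trans (≡.cong (ℤ._+ f (suc (suc n))) (sumTo-front n f)) (ℤP.+-assoc (f 0) _ (f (suc (suc n))))

sumTo≡∑ : ∀ n f → sumTo n f ≡ ∑ℤ (suc n) f
sumTo≡∑ zero    f = ≡.sym (ℤP.+-identityˡ _)
sumTo≡∑ (suc n) f = ≡.cong (ℤ._+ f (suc n)) (sumTo≡∑ n f)

sumTo-extend : ∀ {m n} f → m ≤ n → (∀ k → m < k → f k ≡ + 0) → sumTo m f ≡ sumTo n f
sumTo-extend {m} {n} f m≤n f≡0 = ≡.subst (λ k → sumTo m f ≡ sumTo k f) (ℕP.m+[n∸m]≡n m≤n) (extend (n ∸ m))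
  where
  extend : ∀ e → sumTo m f ≡ sumTo (m + e) f
  extend zero    = ≡.cong (λ k → sumTo k f) (≡.sym (ℕP.+-identityʳ m))
  extend (suc e) = begin
    sumTo m f                               ≡⟨ extend e ⟩
    sumTo (m + e) f                         ≡⟨ ℤP.+-identityʳ _ ⟨
    sumTo (m + e) f ℤ.+ + 0                 ≡⟨ ≡.cong (λ x → sumTo (m + e) f ℤ.+ x) (f≡0 (suc (m + e)) (s≤s (ℕP.m≤m+n m e))) ⟨
    sumTo (suc (m + e)) f                   ≡⟨ ≡.cong (λ k → sumTo k f) (ℕP.+-suc m e) ⟨
    sumTo (m + suc e) f                     ∎
    where open ≡.≡-Reasoning

sumTo-conv : ∀ j f g → sumTo j (λ b → f b ℤ.* g (j ∸ b)) ≡ conv ℤ-ring f g j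
sumTo-conv zero    f g = ≡.refl
sumTo-conv (suc j) f g = ≡.trans (sumTo-front j _) (≡.cong (λ x → f 0 ℤ.* g (suc j) ℤ.+ x) (sumTo-conv j (λ b → f (suc b)) g))

⊛-conv : ∀ J n j f g → (f ⊛ g) n j ≡ conv (q-ring J) f g n j
⊛-conv J zero    j f g = sumTo-conv j (f 0) (g 0)
⊛-conv J (suc n) j f g = ≡.trans (sumTo-front n _)
  (≡.cong₂ ℤ._+_ (sumTo-conv j (f 0) (g (suc n))) (⊛-conv J n j (λ a → f (suc a)) g))

-- `does` of a comparison of successors computes to that of the predecessors; the recursion in
-- `mono-monomial` relies on it.
mono-does : ∀ a b a′ b′ → mono a b a′ b′ ≡ (if does (a ≟ a′) ∧ does (b ≟ b′) then 1ℤ else 0ℤ)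
mono-does a b a′ b′ = ≡.cong₂ (λ x y → if x ∧ y then 1ℤ else 0ℤ) (isYes≗does (a ≟ a′)) (isYes≗does (b ≟ b′))

mono-monomial : ∀ J a b a′ b′ → mono a b a′ b′ ≡ monomial (q-ring J) a (monomial ℤ-ring b 1ℤ) a′ b′
mono-monomial J a b a′ b′ = ≡.trans (mono-does a b a′ b′) (outer a a′)
  where
  inner : ∀ b b′ → (if does (b ≟ b′) then 1ℤ else 0ℤ) ≡ monomial ℤ-ring b 1ℤ b′
  inner zero    zero     = ≡.refl
  inner zero    (suc b′) = ≡.refl
  inner (suc b) zero     = ≡.refl
  inner (suc b) (suc b′) = inner b b′

  outer : ∀ a a′ → (if does (a ≟ a′) ∧ does (b ≟ b′) then 1ℤ else 0ℤ) ≡ monomial (q-ring J) a (monomial ℤ-ring b 1ℤ) a′ b′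
  outer zero    zero     = inner b b′
  outer zero    (suc a′) = ≡.refl
  outer (suc a) zero     = ≡.refl
  outer (suc a) (suc a′) = outer a a′

-- ℤ[q,s]/(s^{n+1}, q^{J+1}), which retains the coefficient of s^n q^J.
module Truncation (n J : ℕ) where
  ring : CommutativeRing 0ℓ 0ℓ
  ring = TruncatedSeries.commutativeRing (q-ring J) n

  module R = CommutativeRing ring
  module Q = CommutativeRing (q-ring J)
  module QC = Convolution (q-ring J)

  ⊛≈* : ∀ f g → (f ⊛ g) R.≈ f R.* g
  ⊛≈* f g a _ b _ = ⊛-conv J a b f g

  mono≈monomial : ∀ a b → mono a b R.≈ monomial (q-ring J) a (monomial ℤ-ring b 1ℤ)
  mono≈monomial a b a′ _ b′ _ = mono-monomial J a b a′ b′

  mono-one : one R.≈ R.1#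
  mono-one = mono≈monomial 0 0

  mono-* : ∀ a b a′ b′ → mono a b R.* mono a′ b′ R.≈ mono (a + a′) (b + b′)
  mono-* a b a′ b′ = begin
    mono a b R.* mono a′ b′
      ≈⟨ R.*-cong {mono a b} {x} {mono a′ b′} {x′} (mono≈monomial a b) (mono≈monomial a′ b′) ⟩
    x R.* x′
      ≈⟨ (λ i _ → QC.conv-monomial i a a′ _ _) ⟩
    monomial (q-ring J) (a + a′) (monomial ℤ-ring b 1ℤ Q.* monomial ℤ-ring b′ 1ℤ)
      ≈⟨ (λ i _ → QC.monomial-cong i (a + a′) (λ j _ → Convolution.conv-monomial ℤ-ring j b b′ 1ℤ 1ℤ)) ⟩
    monomial (q-ring J) (a + a′) (monomial ℤ-ring (b + b′) 1ℤ)
      ≈⟨ mono≈monomial (a + a′) (b + b′) ⟨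
    mono (a + a′) (b + b′) ∎
    where
    open SetoidReasoning R.setoid
    x x′ : Series
    x  = monomial (q-ring J) a (monomial ℤ-ring b 1ℤ)
    x′ = monomial (q-ring J) a′ (monomial ℤ-ring b′ 1ℤ)

  mono-zero : ∀ a b → n < a → mono a b R.≈ R.0#
  mono-zero a b n<a = begin
    mono a b                                              ≈⟨ mono≈monomial a b ⟩
    monomial (q-ring J) a (monomial ℤ-ring b 1ℤ)          ≈⟨ (λ i i≤n → QC.monomial-zero i a _ (ℕP.≤-<-trans i≤n n<a)) ⟩
    R.0#                                                  ∎
    where open SetoidReasoning R.setoid

  open PartialFractions ring n mono mono-one mono-* mono-zero public
  open FiniteSums ring using (∑) public
  open Exp R.commutativeSemiring using (_^_) public

  pow≈^ : ∀ f k → pow f k R.≈ f ^ k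
  pow≈^ f zero    = mono-one
  pow≈^ f (suc k) = begin
    pow f k ⊛ f       ≈⟨ ⊛≈* (pow f k) f ⟩
    pow f k R.* f     ≈⟨ R.*-congʳ {f} {pow f k} {f ^ k} (pow≈^ f k) ⟩
    (f ^ k) R.* f     ≈⟨ R.*-comm (f ^ k) f ⟩
    f ^ suc k         ∎
    where open SetoidReasoning R.setoid

  ∑-coefficient : ∀ N f a b → ∑ N f a b ≡ ∑ℤ N (λ k → f k a b)
  ∑-coefficient zero    f a b = ≡.refl
  ∑-coefficient (suc N) f a b = ≡.cong (ℤ._+ f N a b) (∑-coefficient N f a b)

  ε-coefficient : ∀ k f a b → a ≤ n → b ≤ J → (ε k R.* f) a b ≡ sgn k ℤ.* f a b
  ε-coefficient zero    f a b a≤n b≤J = ≡.trans (R.*-identityˡ f a a≤n b b≤J) (≡.sym (ℤP.*-identityˡ _))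
  ε-coefficient (suc k) f a b a≤n b≤J = begin
    (R.- ε k R.* f) a b           ≡⟨ -‿distribˡ-* (ε k) f a a≤n b b≤J ⟨
    ℤ.- (ε k R.* f) a b           ≡⟨ ≡.cong ℤ.-_ (ε-coefficient k f a b a≤n b≤J) ⟩
    ℤ.- (sgn k ℤ.* f a b)         ≡⟨ ℤP.neg-distribˡ-* (sgn k) (f a b) ⟩
    (ℤ.- sgn k) ℤ.* f a b         ≡⟨ ≡.cong (ℤ._* f a b) (ℤP.-1*i≡-i (sgn k)) ⟨
    sgn (suc k) ℤ.* f a b         ∎
    where
    open ≡.≡-Reasoning
    open RingProperties R.ring using (-‿distribˡ-*)

-- The truncation is taken at the coefficient in question: modulo s^{a+1} the k-th power is already
-- zero.
pow-vanishes : ∀ m {k a} b → a < k → pow ((mono (suc m) (2 + m) ⊕ mono (suc m) m) ⊖ mono (2 * suc m) (2 * suc m)) k a b ≡ + 0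
pow-vanishes m {k} {a} b a<k = ≡.trans (pow≈^ (H m) k a ℕP.≤-refl b ℕP.≤-refl) (H-nilpotent m k a<k a ℕP.≤-refl b ℕP.≤-refl)
  where open Truncation a b

module Expansion (n J : ℕ) where
  open Truncation n J

  -- At s^a `geom` stops at the a-th power while `geo` goes on to the n-th; the powers in between
  -- have no s^a term.
  geom≈d : ∀ m → geom (H m) R.≈ d m
  geom≈d m a a≤n b b≤J = begin
    sumTo a (λ k → pow (H m) k a b)         ≡⟨ sumTo-extend (λ k → pow (H m) k a b) a≤n (λ k a<k → pow-vanishes m b a<k) ⟩
    sumTo n (λ k → pow (H m) k a b)         ≡⟨ sumTo-cong n (λ k → pow≈^ (H m) k a a≤n b b≤J) ⟩
    sumTo n (λ k → (H m ^ k) a b)           ≡⟨ sumTo≡∑ n _ ⟩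
    ∑ℤ (suc n) (λ k → (H m ^ k) a b)        ≡⟨ ∑-coefficient (suc n) (H m ^_) a b ⟨
    d m a b                                 ∎
    where open ≡.≡-Reasoning

  factor≈ : ∀ m → factor (suc m) R.≈ (R.1# R.- T (suc m)) R.* (R.1# R.- T (suc m)) R.* d m
  factor≈ m = begin
    (x ⊛ x) ⊛ geom (H m)      ≈⟨ ⊛≈* (x ⊛ x) (geom (H m)) ⟩
    (x ⊛ x) R.* geom (H m)    ≈⟨ R.*-cong {x ⊛ x} {x R.* x} {geom (H m)} {d m} (⊛≈* x x) (geom≈d m) ⟩
    x R.* x R.* d m           ≈⟨ R.*-congʳ {d m} {x R.* x} {y R.* y} (R.*-cong {x} {y} {x} {y} x≈y x≈y) ⟩
    y R.* y R.* d m           ∎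
    where
    open SetoidReasoning R.setoid
    x y : Series
    x = one ⊖ T (suc m)
    y = R.1# R.- T (suc m)

    x≈y : x R.≈ y
    x≈y = R.+-congʳ {R.- T (suc m)} {one} {R.1#} mono-one

  prodF≈P : ∀ N → prodF N R.≈ P N
  prodF≈P zero    = mono-one
  prodF≈P (suc N) = begin
    prodF N ⊛ factor (suc N)      ≈⟨ ⊛≈* (prodF N) (factor (suc N)) ⟩
    prodF N R.* factor (suc N)    ≈⟨ R.*-cong {prodF N} {P N} {factor (suc N)} (prodF≈P N) (factor≈ N) ⟩
    P (suc N)                     ∎
    where open SetoidReasoning R.setoid

  branch-coefficient : ℕ → ℕ → ℤ
  branch-coefficient k b =
       ∑ℤ (suc n) (λ m → mono (triangular k + (suc k + m * suc k)) (triangular k + (suc k + m * b)) n J)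
    ℤ.- ∑ℤ (suc n) (λ m → mono (triangular k + suc m * suc k) (triangular k + suc m * b) n J)

  branch-at : ∀ k b → branch k b n J ≡ branch-coefficient k b
  branch-at k b = ≡.trans (∑-coefficient (suc n) _ n J) (∑ℤ-distrib-- (suc n) _ _)

  C-expansion : 1 ≤ n → C n J ≡ ∑ℤ n (λ k → sgn (suc k) ℤ.* (branch-coefficient k (2 + k) ℤ.+ branch-coefficient k k))
  C-expansion 1≤n = begin
    C n J
      ≡⟨ prodF≈P n n ℕP.≤-refl J ℕP.≤-refl ⟩
    P n n J
      ≡⟨ P-expansion n ℕP.≤-refl J ℕP.≤-refl ⟩
    R.1# n J ℤ.+ ∑ n (λ k → ε (suc k) R.* (branch k (2 + k) R.+ branch k k)) n J
      -- For n ≥ 1 the leading 1 of the expansion has no s^n term.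
      ≡⟨ ≡.cong₂ ℤ._+_ (1#-at 1≤n) (∑-coefficient n _ n J) ⟩
    + 0 ℤ.+ ∑ℤ n (λ k → (ε (suc k) R.* (branch k (2 + k) R.+ branch k k)) n J)
      ≡⟨ ℤP.+-identityˡ _ ⟩
    ∑ℤ n (λ k → (ε (suc k) R.* (branch k (2 + k) R.+ branch k k)) n J)
      ≡⟨ ∑ℤ-cong n (λ k → ≡.trans (ε-coefficient (suc k) _ n J ℕP.≤-refl ℕP.≤-refl)
           (≡.cong (sgn (suc k) ℤ.*_) (≡.cong₂ ℤ._+_ (branch-at k (2 + k)) (branch-at k k)))) ⟩
    ∑ℤ n (λ k → sgn (suc k) ℤ.* (branch-coefficient k (2 + k) ℤ.+ branch-coefficient k k)) ∎
    where
    open ≡.≡-Reasoning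
    1#-at : ∀ {n} → 1 ≤ n → R.1# n J ≡ + 0
    1#-at (s≤s _) = ≡.refl

-- Reading off single coefficients.

δ : ℕ → ℕ → ℤ
δ x n = if does (x ≟ n) then 1ℤ else 0ℤ

δ-refl : ∀ n → δ n n ≡ + 1
δ-refl n = ≡.cong (if_then 1ℤ else 0ℤ) (dec-true (n ≟ n) ≡.refl)

δ-≢ : ∀ {x n} → x ≢ n → δ x n ≡ + 0
δ-≢ {x} {n} x≢n = ≡.cong (if_then 1ℤ else 0ℤ) (dec-false (x ≟ n) x≢n)

mono≡δ : ∀ {x y n j} → (x ≡ n → y ≡ j) → mono x y n j ≡ δ x n
mono≡δ {x} {y} {n} {j} y≡j = ≡.trans (mono-does x y n j) (split (x ≟ n))
  where
  split : (x≟n : Dec (x ≡ n)) → (if does x≟n ∧ does (y ≟ j) then 1ℤ else 0ℤ) ≡ (if does x≟n then 1ℤ else 0ℤ)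
  split (yes x≡n) = ≡.cong (if_then 1ℤ else 0ℤ) (dec-true (y ≟ j) (y≡j x≡n))
  split (no _)    = ≡.refl

mono≡0 : ∀ {x y n j} → (x ≡ n → y ≢ j) → mono x y n j ≡ + 0
mono≡0 {x} {y} {n} {j} y≢j = ≡.trans (mono-does x y n j) (split (x ≟ n))
  where
  split : (x≟n : Dec (x ≡ n)) → (if does x≟n ∧ does (y ≟ j) then 1ℤ else 0ℤ) ≡ + 0
  split (yes x≡n) = ≡.cong (if_then 1ℤ else 0ℤ) (dec-false (y ≟ j) (y≢j x≡n))
  split (no _)    = ≡.refl

∑ℤ-zero : ∀ N f → (∀ k → k < N → f k ≡ + 0) → ∑ℤ N f ≡ + 0
∑ℤ-zero zero    f f≡0 = ≡.refl
∑ℤ-zero (suc N) f f≡0 = ≡.cong₂ ℤ._+_ (∑ℤ-zero N f (λ k k<N → f≡0 k (ℕP.m<n⇒m<1+n k<N))) (f≡0 N ℕP.≤-refl)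

∑ℤ-single : ∀ {N i} f → i < N → (∀ k → k ≢ i → f k ≡ + 0) → ∑ℤ N f ≡ f i
∑ℤ-single {suc N} {i} f (s≤s i≤N) f≡0 with ℕP.m≤n⇒m<n∨m≡n i≤N
... | inj₁ i<N    = ≡.trans (≡.cong₂ ℤ._+_ (∑ℤ-single f i<N f≡0) (f≡0 N (ℕP.>⇒≢ i<N))) (ℤP.+-identityʳ _)
... | inj₂ ≡.refl = ≡.trans (≡.cong (ℤ._+ f N) (∑ℤ-zero N f (λ k k<N → f≡0 k (ℕP.<⇒≢ k<N)))) (ℤP.+-identityˡ _)

-- With K = k + 1 these are K(K + 2i + 1)/2 and K(K + 2i - 1)/2, the two families of (b). They are
-- the s-exponents of the positive and the negative terms of a branch.
upper lower : ℕ → ℕ → ℕ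
upper i k = triangular k + (suc k + i * suc k)
lower i k = triangular k + i * suc k

-- Within each branch the exponents (x, y) of s and q are tied by y = x + c or y + c = x,
-- where c = m for the positive and c = suc m for the negative terms.
module BranchValue (n J k b : ℕ) where
  open Expansion n J using (branch-coefficient)

  yᵘ yˡ : ℕ → ℕ
  yᵘ m = triangular k + (suc k + m * b)
  yˡ m = triangular k + m * b

  branch-hit : ∀ i → suc i ≤ n →
    (∀ m → upper m k ≡ n → yᵘ m ≡ J → m ≡ suc i) → (upper (suc i) k ≡ n → yᵘ (suc i) ≡ J) →
    (∀ m → lower m k ≡ n → yˡ m ≡ J → m ≡ suc i) → (lower (suc i) k ≡ n → yˡ (suc i) ≡ J) →
    branch-coefficient k b ≡ δ (upper (suc i) k) n ℤ.- δ (lower (suc i) k) n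
  branch-hit i i<n onlyᵘ hitᵘ onlyˡ hitˡ = ≡.cong₂ ℤ._-_
    (≡.trans (∑ℤ-single _ (s≤s i<n) (λ m m≢ → mono≡0 (λ p q → m≢ (onlyᵘ m p q)))) (mono≡δ hitᵘ))
    -- The negative sum is shifted by one: its summand m carries the power m + 1, so the hit is at
    -- index `i`, not `suc i`.
    (≡.trans (∑ℤ-single _ (ℕP.m≤n⇒m≤1+n i<n) (λ m m≢ → mono≡0 (λ p q → m≢ (ℕP.suc-injective (onlyˡ (suc m) p q))))) (mono≡δ hitˡ))

  branch-middle :
    (∀ m → upper m k ≡ n → yᵘ m ≡ J → m ≡ 0) → (upper 0 k ≡ n → yᵘ 0 ≡ J) →
    (∀ m → lower (suc m) k ≡ n → yˡ (suc m) ≢ J) →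
    branch-coefficient k b ≡ δ (upper 0 k) n
  branch-middle onlyᵘ hitᵘ missˡ = ≡.trans (≡.cong₂ ℤ._-_
    (≡.trans (∑ℤ-single {suc n} _ (s≤s z≤n) (λ m m≢ → mono≡0 (λ p q → m≢ (onlyᵘ m p q)))) (mono≡δ hitᵘ))
    (∑ℤ-zero (suc n) _ (λ m _ → mono≡0 (missˡ m)))) (ℤP.+-identityʳ _)

  branch-miss : (∀ m → upper m k ≡ n → yᵘ m ≢ J) → (∀ m → lower (suc m) k ≡ n → yˡ (suc m) ≢ J) →
    branch-coefficient k b ≡ + 0
  branch-miss missᵘ missˡ = ≡.cong₂ ℤ._-_ (∑ℤ-zero (suc n) _ (λ m _ → mono≡0 (missᵘ m))) (∑ℤ-zero (suc n) _ (λ m _ → mono≡0 (missˡ m)))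

module _ (k : ℕ) where
  open +-*-Solver

  raise-upper : ∀ m → triangular k + (suc k + m * (2 + k)) ≡ upper m k + m
  raise-upper m = solve 3 (λ p k m → p :+ ((con 1 :+ k) :+ m :* (con 2 :+ k)) := p :+ ((con 1 :+ k) :+ m :* (con 1 :+ k)) :+ m) ≡.refl (triangular k) k m

  raise-lower : ∀ m → triangular k + m * (2 + k) ≡ lower m k + m
  raise-lower m = solve 3 (λ p k m → p :+ m :* (con 2 :+ k) := p :+ m :* (con 1 :+ k) :+ m) ≡.refl (triangular k) k m

  drop-upper : ∀ m → triangular k + (suc k + m * k) + m ≡ upper m k
  drop-upper m = solve 3 (λ p k m → p :+ ((con 1 :+ k) :+ m :* k) :+ m := p :+ ((con 1 :+ k) :+ m :* (con 1 :+ k))) ≡.refl (triangular k) k m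

  drop-lower : ∀ m → triangular k + m * k + m ≡ lower m k
  drop-lower m = solve 3 (λ p k m → p :+ m :* k :+ m := p :+ m :* (con 1 :+ k)) ≡.refl (triangular k) k m

raise-injective : ∀ {x y n m i} → y ≡ x + m → x ≡ n → y ≡ n + i → m ≡ i
raise-injective {x} {m = m} {i} y≡x+m ≡.refl y≡x+i = ℕP.+-cancelˡ-≡ x m i (≡.trans (≡.sym y≡x+m) y≡x+i)

drop-injective : ∀ {x y n J m i} → y + m ≡ x → J + i ≡ n → x ≡ n → y ≡ J → m ≡ i
drop-injective {J = J} {m} {i} y+m≡x J+i≡n ≡.refl ≡.refl = ℕP.+-cancelˡ-≡ J m i (≡.trans y+m≡x (≡.sym J+i≡n))

raise-drop : ∀ {x y n m i} → y + m ≡ x → x ≡ n → y ≢ n + suc i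
raise-drop {m = m} {i} y+m≡x ≡.refl y≡x+1+i = ℕP.m≢1+m+n _ (≡.trans (≡.sym y+m≡x) (≡.trans (≡.cong (λ y → y + m) y≡x+1+i) (≡.trans (ℕP.+-assoc _ (suc i) m) (ℕP.+-suc _ (i + m)))))

drop-raise : ∀ {x y n J m i} → y ≡ x + m → J + suc i ≡ n → x ≡ n → y ≢ J
drop-raise {x} {J = J} {m} {i} y≡x+m J+1+i≡n ≡.refl ≡.refl =
  ℕP.m≢1+m+n x (≡.trans (≡.sym J+1+i≡n) (≡.trans (≡.cong (_+ suc i) y≡x+m) (≡.trans (ℕP.+-assoc x m (suc i)) (≡.trans (≡.cong (λ y → x + y) (ℕP.+-suc m i)) (ℕP.+-suc x (m + i))))))

-- The integer c_{n,i} for i ≥ 1, before it is known that at most one indicator is nonzero.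
theta : ℕ → ℕ → ℤ
theta n i = ∑ℤ n (λ k → sgn (suc k) ℤ.* (δ (upper i k) n ℤ.- δ (lower i k) n))

-- In the branch of q t^{k+1} the exponent of q is never below that of s, and the excess determines
-- the summand; the branch of q⁻¹ t^{k+1} never exceeds the diagonal. Below the diagonal the roles
-- are exchanged.
C-above : ∀ n i → suc i ≤ n → C n (n + suc i) ≡ theta n (suc i)
C-above n i i<n = ≡.trans (C-expansion (ℕP.≤-trans (s≤s z≤n) i<n)) (∑ℤ-cong n (λ k → ≡.cong (sgn (suc k) ℤ.*_)
  (≡.trans (≡.cong₂ ℤ._+_
    (BranchValue.branch-hit n (n + suc i) k (2 + k) i i<n
      (λ m → raise-injective (raise-upper k m)) (λ p → ≡.trans (raise-upper k (suc i)) (≡.cong (_+ suc i) p))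
      (λ m → raise-injective (raise-lower k m)) (λ p → ≡.trans (raise-lower k (suc i)) (≡.cong (_+ suc i) p)))
    (BranchValue.branch-miss n (n + suc i) k k
      (λ m → raise-drop (drop-upper k m)) (λ m → raise-drop (drop-lower k (suc m)))))
  (ℤP.+-identityʳ _))))
  where open Expansion n (n + suc i)

C-below : ∀ n i → suc i ≤ n → C n (n ∸ suc i) ≡ theta n (suc i)
C-below n i i<n = ≡.trans (C-expansion (ℕP.≤-trans (s≤s z≤n) i<n)) (∑ℤ-cong n (λ k → ≡.cong (sgn (suc k) ℤ.*_)
  (≡.trans (≡.cong₂ ℤ._+_
    (BranchValue.branch-miss n (n ∸ suc i) k (2 + k)
      (λ m → drop-raise (raise-upper k m) J+1+i≡n) (λ m → drop-raise (raise-lower k (suc m)) J+1+i≡n))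
    (BranchValue.branch-hit n (n ∸ suc i) k k i i<n
      (λ m → drop-injective (drop-upper k m) J+1+i≡n) (λ p → ℕP.+-cancelʳ-≡ (suc i) _ _ (≡.trans (drop-upper k (suc i)) (≡.trans p (≡.sym J+1+i≡n))))
      (λ m → drop-injective (drop-lower k m) J+1+i≡n) (λ p → ℕP.+-cancelʳ-≡ (suc i) _ _ (≡.trans (drop-lower k (suc i)) (≡.trans p (≡.sym J+1+i≡n))))))
  (ℤP.+-identityˡ _))))
  where
  open Expansion n (n ∸ suc i)
  J+1+i≡n : n ∸ suc i + suc i ≡ n
  J+1+i≡n = ℕP.m∸n+n≡m i<n

-- On the diagonal only the zeroth positive term of each branch survives, and it is the same
-- monomial in both: this is the 2 in (a).
C-middle : ∀ n → 1 ≤ n → C n n ≡ ∑ℤ n (λ k → sgn (suc k) ℤ.* (δ (upper 0 k) n ℤ.+ δ (upper 0 k) n))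
C-middle n 1≤n = ≡.trans (C-expansion 1≤n) (∑ℤ-cong n (λ k → ≡.cong (sgn (suc k) ℤ.*_) (≡.cong₂ ℤ._+_
    (BranchValue.branch-middle n n k (2 + k)
      (λ m p q → raise-injective (raise-upper k m) p (≡.trans q n≡n+0)) (λ p → p)
      (λ m p q → ℕP.1+n≢0 (raise-injective (raise-lower k (suc m)) p (≡.trans q n≡n+0))))
    (BranchValue.branch-middle n n k k
      (λ m → drop-injective (drop-upper k m) n+0≡n) (λ p → p)
      (λ m p q → ℕP.1+n≢0 (drop-injective (drop-lower k (suc m)) n+0≡n p q))))))
  where
  open Expansion n n
  n+0≡n : n + 0 ≡ n
  n+0≡n = ℕP.+-identityʳ n
  n≡n+0 : n ≡ n + 0
  n≡n+0 = ≡.sym n+0≡n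

-- Interlacing of the two families of exponents.

triangular-mono : ∀ {k l} → k ≤ l → triangular k ≤ triangular l
triangular-mono z≤n       = z≤n
triangular-mono (s≤s k≤l) = ℕP.+-mono-≤ (triangular-mono k≤l) (s≤s k≤l)

lower-mono : ∀ i {k l} → k ≤ l → lower i k ≤ lower i l
lower-mono i k≤l = ℕP.+-mono-≤ (triangular-mono k≤l) (ℕP.*-monoʳ-≤ i (s≤s k≤l))

lower<upper : ∀ i {k l} → l ≤ k → lower i l < upper i k
lower<upper i {k} {l} l≤k = ℕP.≤-<-trans (lower-mono i l≤k) (ℕP.+-monoʳ-< (triangular k) (ℕP.m<n+m (i * suc k) (s≤s z≤n)))

upper≤lower : ∀ i {k l} → k < l → upper i k ≤ lower i l
upper≤lower i {k} {l} k<l = ≡.subst (_≤ lower i l) (ℕP.+-assoc (triangular k) (suc k) (i * suc k))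
  (ℕP.+-mono-≤ (triangular-mono k<l) (ℕP.*-monoʳ-≤ i (ℕP.m≤n⇒m≤1+n k<l)))

-- The gap between `upper i k` and `lower i (suc k)` is i. It closes at i = 0, hence `suc i` here;
-- for i ≥ 1 the values strictly alternate.
upper<lower : ∀ i {k l} → k < l → upper (suc i) k < lower (suc i) l
upper<lower i {k} {l} k<l = ≡.subst (_< lower (suc i) l) (ℕP.+-assoc (triangular k) (suc k) (suc i * suc k))
  (ℕP.+-mono-≤-< (triangular-mono k<l) (ℕP.*-monoʳ-< (suc i) (s≤s k<l)))

upper-strict : ∀ i {k l} → k < l → upper i k < upper i l
upper-strict i k<l = ℕP.≤-<-trans (upper≤lower i k<l) (lower<upper i ℕP.≤-refl)

lower-strict : ∀ i {k l} → k < l → lower i k < lower i l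
lower-strict i k<l = ℕP.<-≤-trans (lower<upper i ℕP.≤-refl) (upper≤lower i k<l)

upper≢lower : ∀ i k l → upper (suc i) k ≢ lower (suc i) l
upper≢lower i k l with ℕP.≤-<-connex l k
... | inj₁ l≤k = ℕP.>⇒≢ (lower<upper (suc i) l≤k)
... | inj₂ k<l = ℕP.<⇒≢ (upper<lower i k<l)

strict⇒injective : ∀ {f : ℕ → ℕ} → (∀ {k l} → k < l → f k < f l) → ∀ {k l} → l ≢ k → f l ≢ f k
strict⇒injective strict {k} {l} l≢k with ℕP.<-cmp l k
... | tri< l<k _ _ = ℕP.<⇒≢ (strict l<k)
... | tri≈ _ l≡k _ = contradiction l≡k l≢k
... | tri> _ _ k<l = ℕP.>⇒≢ (strict k<l)

k<upper : ∀ i k → k < upper i k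
k<upper i k = ℕP.≤-trans (ℕP.m≤m+n (suc k) (i * suc k)) (ℕP.m≤n+m _ (triangular k))

k<lower : ∀ i k → k < lower (suc i) k
k<lower i k = ℕP.≤-trans (ℕP.m≤m+n (suc k) (i * suc k)) (ℕP.m≤n+m _ (triangular k))

-- Closed forms of the exponents.

double-triangular : ∀ k → 2 * triangular k ≡ k * suc k
double-triangular zero    = ≡.refl
double-triangular (suc k) = begin
  2 * (triangular k + suc k)      ≡⟨ ℕP.*-distribˡ-+ 2 (triangular k) (suc k) ⟩
  2 * triangular k + 2 * suc k    ≡⟨ ≡.cong (_+ 2 * suc k) (double-triangular k) ⟩
  k * suc k + 2 * suc k           ≡⟨ solve 1 (λ k → k :* (con 1 :+ k) :+ con 2 :* (con 1 :+ k) := (con 1 :+ k) :* (con 2 :+ k)) ≡.refl k ⟩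
  suc k * suc (suc k)             ∎
  where
  open ≡.≡-Reasoning
  open +-*-Solver

double-upper : ∀ i k → 2 * upper i k ≡ suc k * (suc k + 2 * i + 1)
double-upper i k = begin
  2 * (triangular k + (suc k + i * suc k))       ≡⟨ ℕP.*-distribˡ-+ 2 (triangular k) _ ⟩
  2 * triangular k + 2 * (suc k + i * suc k)     ≡⟨ ≡.cong (_+ 2 * (suc k + i * suc k)) (double-triangular k) ⟩
  k * suc k + 2 * (suc k + i * suc k)
    ≡⟨ solve 2 (λ i k → k :* (con 1 :+ k) :+ con 2 :* (con 1 :+ k :+ i :* (con 1 :+ k)) := (con 1 :+ k) :* (con 1 :+ k :+ con 2 :* i :+ con 1)) ≡.refl i k ⟩
  suc k * (suc k + 2 * i + 1)                    ∎
  where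
  open ≡.≡-Reasoning
  open +-*-Solver

double-lower : ∀ i k → 2 * lower i k ≡ suc k * (suc k + 2 * i ∸ 1)
double-lower i k = begin
  2 * (triangular k + i * suc k)            ≡⟨ ℕP.*-distribˡ-+ 2 (triangular k) _ ⟩
  2 * triangular k + 2 * (i * suc k)        ≡⟨ ≡.cong (_+ 2 * (i * suc k)) (double-triangular k) ⟩
  k * suc k + 2 * (i * suc k)
    ≡⟨ solve 2 (λ i k → k :* (con 1 :+ k) :+ con 2 :* (i :* (con 1 :+ k)) := (con 1 :+ k) :* (k :+ con 2 :* i)) ≡.refl i k ⟩
  -- `suc k + 2 * i ∸ 1` computes to `k + 2 * i`, so the truncated subtraction loses nothing.
  suc k * (k + 2 * i)                       ∎
  where
  open ≡.≡-Reasoning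
  open +-*-Solver

upper≡ : ∀ n i k → 2 * n ≡ suc k * (suc k + 2 * i + 1) → upper i k ≡ n
upper≡ n i k p = ℕP.*-cancelˡ-≡ _ _ 2 (≡.trans (double-upper i k) (≡.sym p))

lower≡ : ∀ n i k → 2 * n ≡ suc k * (suc k + 2 * i ∸ 1) → lower i k ≡ n
lower≡ n i k p = ℕP.*-cancelˡ-≡ _ _ 2 (≡.trans (double-lower i k) (≡.sym p))

-- Evaluation of the signed sums.

signed-zero : ∀ s {x y} → x ≡ + 0 → y ≡ + 0 → s ℤ.* (x ℤ.- y) ≡ + 0
signed-zero s ≡.refl ≡.refl = ℤP.*-zeroʳ s

theta-upper : ∀ i k → theta (upper (suc i) k) (suc i) ≡ sgn (suc k)
theta-upper i k = ≡.trans
  (∑ℤ-single _ (k<upper (suc i) k) (λ l l≢k → signed-zero (sgn (suc l))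
    (δ-≢ (strict⇒injective (upper-strict (suc i)) l≢k)) (δ-≢ (≡.≢-sym (upper≢lower i k l)))))
  (≡.trans (≡.cong₂ (λ x y → sgn (suc k) ℤ.* (x ℤ.- y)) (δ-refl (upper (suc i) k)) (δ-≢ (≡.≢-sym (upper≢lower i k k)))) (ℤP.*-identityʳ _))

theta-lower : ∀ i k → theta (lower (suc i) k) (suc i) ≡ sgn k
theta-lower i k = ≡.trans
  (∑ℤ-single _ (k<lower i k) (λ l l≢k → signed-zero (sgn (suc l))
    (δ-≢ (upper≢lower i l k)) (δ-≢ (strict⇒injective (lower-strict (suc i)) l≢k))))
  (≡.trans (≡.cong₂ (λ x y → sgn (suc k) ℤ.* (x ℤ.- y)) (δ-≢ (upper≢lower i k k)) (δ-refl (lower (suc i) k)))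
    -- The minus sign of the negative terms cancels one factor of `sgn (suc k)`, which is where the
    -- exponent k - 1 in (b) comes from.
    (≡.trans (ℤP.*-assoc -1ℤ (sgn k) -1ℤ) (≡.trans (ℤP.-1*i≡-i _) (≡.trans (≡.cong ℤ.-_ (≡.trans (ℤP.*-comm (sgn k) -1ℤ) (ℤP.-1*i≡-i _))) (ℤP.neg-involutive _)))))

theta-zero : ∀ n i → (∀ k → upper i k ≢ n) → (∀ k → lower i k ≢ n) → theta n i ≡ + 0
theta-zero n i upper≢n lower≢n = ∑ℤ-zero n _ (λ k _ → signed-zero (sgn (suc k)) (δ-≢ (upper≢n k)) (δ-≢ (lower≢n k)))

C-middle-upper : ∀ k → C (upper 0 k) (upper 0 k) ≡ + 2 ℤ.* sgn (suc k)
C-middle-upper k = ≡.trans (C-middle (upper 0 k) (ℕP.≤-trans (s≤s z≤n) (k<upper 0 k))) (≡.trans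
  (∑ℤ-single _ (k<upper 0 k) (λ l l≢k → zero-at l (δ-≢ (strict⇒injective (upper-strict 0) l≢k))))
  (≡.trans (≡.cong (λ x → sgn (suc k) ℤ.* (x ℤ.+ x)) (δ-refl (upper 0 k))) (ℤP.*-comm (sgn (suc k)) (+ 2))))
  where
  zero-at : ∀ l {x} → x ≡ + 0 → sgn (suc l) ℤ.* (x ℤ.+ x) ≡ + 0
  zero-at l ≡.refl = ℤP.*-zeroʳ (sgn (suc l))

C-middle-zero : ∀ n → 1 ≤ n → (∀ k → upper 0 k ≢ n) → C n n ≡ + 0
C-middle-zero n 1≤n upper≢n = ≡.trans (C-middle n 1≤n) (∑ℤ-zero n _ (λ k _ →
  ≡.trans (≡.cong (λ x → sgn (suc k) ℤ.* (x ℤ.+ x)) (δ-≢ (upper≢n k))) (ℤP.*-zeroʳ (sgn (suc k)))))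

C-off-middle : ∀ {n i x} → suc i ≤ n → theta n (suc i) ≡ x → C n (n + suc i) ≡ x × C n (n ∸ suc i) ≡ x
C-off-middle {n} {i} i<n p = ≡.trans (C-above n i i<n) p , ≡.trans (C-below n i i<n) p

theorem1p1 : (n : ℕ) → 1 ≤ n →
    ((∀ k → 1 ≤ k → 2 * n ≡ k * (k + 1) → C n n ≡ (+ 2) *ℤ sgn k)
    × ((¬ (∃[ k ] (1 ≤ k × 2 * n ≡ k * (k + 1)))) → C n n ≡ + 0))
    × (∀ i → 1 ≤ i → i ≤ n →
    (∀ k → 1 ≤ k → 2 * n ≡ k * (k + 2 * i + 1) →
    (C n (n + i) ≡ sgn k) × (C n (n ∸ i) ≡ sgn k))
    × (∀ k → 1 ≤ k → 2 * n ≡ k * (k + 2 * i ∸ 1) →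
    (C n (n + i) ≡ sgn (k ∸ 1)) × (C n (n ∸ i) ≡ sgn (k ∸ 1)))
    × ((¬ (∃[ k ] (1 ≤ k × 2 * n ≡ k * (k + 2 * i + 1))))
    → (¬ (∃[ k ] (1 ≤ k × 2 * n ≡ k * (k + 2 * i ∸ 1))))
    → (C n (n + i) ≡ + 0) × (C n (n ∸ i) ≡ + 0)))
theorem1p1 n 1≤n = (middle , middle-zero) , λ where
    zero    ()
    (suc i) _ i<n →
        (λ where (suc k) _ p → C-off-middle i<n (≡.subst (λ n → theta n (suc i) ≡ sgn (suc k)) (upper≡ n (suc i) k p) (theta-upper i k)))
      , (λ where (suc k) _ p → C-off-middle i<n (≡.subst (λ n → theta n (suc i) ≡ sgn k) (lower≡ n (suc i) k p) (theta-lower i k)))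
      , (λ ¬upper ¬lower → C-off-middle i<n (theta-zero n (suc i)
          (λ k p → ¬upper (suc k , s≤s z≤n , ≡.trans (≡.cong (2 *_) (≡.sym p)) (double-upper (suc i) k)))
          (λ k p → ¬lower (suc k , s≤s z≤n , ≡.trans (≡.cong (2 *_) (≡.sym p)) (double-lower (suc i) k)))))
  where
  -- Part (a) uses the `upper` family at i = 0.
  k+0+1≡k+1 : ∀ k → k * (k + 2 * 0 + 1) ≡ k * (k + 1)
  k+0+1≡k+1 k = ≡.cong (λ m → k * (m + 1)) (ℕP.+-identityʳ k)

  middle : ∀ k → 1 ≤ k → 2 * n ≡ k * (k + 1) → C n n ≡ (+ 2) *ℤ sgn k
  middle (suc k) _ p = ≡.subst (λ n → C n n ≡ + 2 *ℤ sgn (suc k))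
    (upper≡ n 0 k (≡.trans p (≡.sym (k+0+1≡k+1 (suc k))))) (C-middle-upper k)

  middle-zero : ¬ (∃[ k ] (1 ≤ k × 2 * n ≡ k * (k + 1))) → C n n ≡ + 0
  middle-zero ¬k = C-middle-zero n 1≤n (λ k p → ¬k (suc k , s≤s z≤n ,
    ≡.trans (≡.cong (2 *_) (≡.sym p)) (≡.trans (double-upper 0 k) (k+0+1≡k+1 (suc k)))))
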